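{- Let $t\geq 1$ be an integer. If $G$ is a connected $U(H_t)$-minor-free graph, then $c(G)\leq t+2$.
   Context: All graphs are finite and simple. $H_t$ is the graph formed from $t$ copies of a five-vertex path by identifying all their first vertices into one vertex $a$ and all their last vertices into one vertex $b$ (so $H_t$ consists of $t$ internally vertex-disjoint $a$–$b$ paths with 4 edges each). For a graph $F$, $U(F)$ denotes the graph obtained from $F$ by adding a new vertex adjacent to all vertices of $F$. A graph $G$ is $H$-minor-free if no graph isomorphic to $H$ can be obtained from $G$ by deleting vertices, deleting edges and contracting edges. Cop number: in the game of cops and robbers on $G$, one player places $m$ cops on (not necessarily distinct) vertices, then the other player places the robber on a vertex. Then, starting with the cops, the players alternate turns; on a turn, a player may move any of their pieces to an adjacent vertex (each piece moves at most once, and any piece may stay put). The cops win if at some point some cop occupies the same vertex as the robber; the robber wins by evading capture forever. The cop number $c(G)$ is the minimum $m$ such that the cops have a winning strategy. -}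

module Defs where

open import Data.Empty using (⊥)
open import Data.Fin using (Fin; suc; inject₁; punchIn; punchOut; _≟_)
open import Data.Fin.Patterns using (0F; 1F; 2F; 3F; 4F)
open import Data.Fin.Properties using (any?)
open import Data.List using (List; []; _∷_)
open import Data.Maybe using (Maybe; just; nothing)
open import Data.Nat using (ℕ; zero; suc; _≤_)
open import Data.Product using (Σ; ∃; ∃₂; _×_; _,_)
open import Data.Sum using (_⊎_; inj₁; inj₂; swap)
open import Data.Unit using (⊤; tt)
open import Data.Vec using (Vec)
open import Data.Vec.Membership.Propositional using (_∈_)
open import Data.Vec.Relation.Binary.Pointwise.Inductive using (Pointwise)
open import Function using (_∘_; _⇔_; _↔_; Inverse)
open import Level using (0ℓ)
open import Relation.Binary using (Rel; Decidable; DecidableEquality; Irreflexive; Symmetric)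
open import Relation.Binary.Construct.Closure.Reflexive using (ReflClosure)
open import Relation.Binary.Construct.Closure.ReflexiveTransitive using (Star)
open import Relation.Binary.PropositionalEquality using (_≡_; _≢_; refl; sym; trans; cong)
open import Relation.Nullary using (¬_; yes; no)
open import Relation.Nullary.Decidable using (_×-dec_; _⊎-dec_; ¬?; map′)

-- A simple graph on the vertex set V.  Finite graphs are the graphs on Fin n;
-- decidability of adjacency is automatic for them classically.
record Graph (V : Set) : Set₁ where
  infix 4 _~_ _~?_
  field
    _~_      : Rel V 0ℓ
    ~-sym    : Symmetric _~_
    ~-irrefl : Irreflexive _≡_ _~_
    _~?_     : Decidable _~_

record _≅_ {V W : Set} (G : Graph V) (H : Graph W) : Set where
  private
    module G = Graph G
    module H = Graph H
  field
    bijection : V ↔ W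
    preserves : ∀ x y → (x G.~ y) ⇔ (Inverse.to bijection x H.~ Inverse.to bijection y)

Connected : {V : Set} → Graph V → Set
Connected G = ∀ x y → Star (Graph._~_ G) x y

------------------------------------------------------------------------
-- Minors

deleteVertex : ∀ {n} → Graph (Fin (suc n)) → Fin (suc n) → Graph (Fin n)
deleteVertex G v = record
  { _~_      = λ x y → punchIn v x ~ punchIn v y
  ; ~-sym    = ~-sym
  ; ~-irrefl = ~-irrefl ∘ cong (punchIn v)
  ; _~?_     = λ x y → punchIn v x ~? punchIn v y
  }
  where open Graph G

deleteEdge : ∀ {n} → Graph (Fin n) → Fin n → Fin n → Graph (Fin n)
deleteEdge {n} G u v = record
  { _~_      = λ x y → (x ~ y) × ¬ IsUV x y
  ; ~-sym    = λ (e , x) → ~-sym e , x ∘ swapUV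
  ; ~-irrefl = λ x≡y (e , _) → ~-irrefl x≡y e
  ; _~?_     = λ x y → (x ~? y) ×-dec
                 ¬? (((x ≟ u) ×-dec (y ≟ v)) ⊎-dec ((x ≟ v) ×-dec (y ≟ u)))
  }
  where
  open Graph G
  IsUV : Rel (Fin n) 0ℓ
  IsUV x y = (x ≡ u × y ≡ v) ⊎ (x ≡ v × y ≡ u)
  swapUV : ∀ {x y} → IsUV y x → IsUV x y
  swapUV (inj₁ (p , q)) = inj₂ (q , p)
  swapUV (inj₂ (p , q)) = inj₁ (q , p)

-- The quotient map Fin (suc n) → Fin n identifying v with u.
merge : ∀ {n} (u v : Fin (suc n)) → v ≢ u → Fin (suc n) → Fin n
merge u v v≢u w with v ≟ w
... | yes _   = punchOut v≢u
... | no  v≢w = punchOut v≢w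

-- Contraction to a simple graph: the image of G under the quotient map, with
-- loops dropped and parallel edges identified.
contract : ∀ {n} → Graph (Fin (suc n)) → (u v : Fin (suc n)) → v ≢ u → Graph (Fin n)
contract G u v v≢u = record
  { _~_      = λ x y → x ≢ y × ∃₂ λ x′ y′ → π x′ ≡ x × π y′ ≡ y × x′ ~ y′
  ; ~-sym    = λ (x≢y , x′ , y′ , p , q , e) → x≢y ∘ sym , y′ , x′ , q , p , ~-sym e
  ; ~-irrefl = λ x≡y (x≢y , _) → x≢y x≡y
  ; _~?_     = λ x y → ¬? (x ≟ y) ×-dec
                 any? λ x′ → any? λ y′ → (π x′ ≟ x) ×-dec (π y′ ≟ y) ×-dec (x′ ~? y′)
  }
  where
  open Graph G
  π = merge u v v≢u

-- HasMinor G H: a graph isomorphic to H can be obtained from G by a sequence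
-- of vertex deletions, edge deletions and edge contractions.
data HasMinor {W : Set} : ∀ {n} → Graph (Fin n) → Graph W → Set₁ where
  isomorphic : ∀ {n} {G : Graph (Fin n)} {H : Graph W} →
    G ≅ H → HasMinor G H
  by-deleteVertex : ∀ {n} {G : Graph (Fin (suc n))} {H : Graph W} (v : Fin (suc n)) →
    HasMinor (deleteVertex G v) H → HasMinor G H
  by-deleteEdge : ∀ {n} {G : Graph (Fin n)} {H : Graph W} (u v : Fin n) →
    Graph._~_ G u v → HasMinor (deleteEdge G u v) H → HasMinor G H
  by-contract : ∀ {n} {G : Graph (Fin (suc n))} {H : Graph W} (u v : Fin (suc n)) →
    Graph._~_ G u v → (v≢u : v ≢ u) → HasMinor (contract G u v v≢u) H → HasMinor G H

MinorFree : ∀ {W n} → Graph W → Graph (Fin n) → Set₁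
MinorFree H G = ¬ HasMinor G H

------------------------------------------------------------------------
-- The graphs H t and U F

data Hᵥ (t : ℕ) : Set where
  a b   : Hᵥ t
  inner : Fin t → Fin 3 → Hᵥ t

-- glue i j is the image in H t of the j-th vertex of the i-th five-vertex path.
glue : ∀ {t} → Fin t → Fin 5 → Hᵥ t
glue i 0F = a
glue i 1F = inner i 0F
glue i 2F = inner i 1F
glue i 3F = inner i 2F
glue i 4F = b

_≟ᴴ_ : ∀ {t} → DecidableEquality (Hᵥ t)
a         ≟ᴴ a         = yes refl
a         ≟ᴴ b         = no λ ()
a         ≟ᴴ inner _ _ = no λ ()
b         ≟ᴴ a         = no λ ()
b         ≟ᴴ b         = yes refl
b         ≟ᴴ inner _ _ = no λ ()
inner _ _ ≟ᴴ a         = no λ ()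
inner _ _ ≟ᴴ b         = no λ ()
inner i j ≟ᴴ inner k l =
  map′ (λ { (refl , refl) → refl }) (λ { refl → refl , refl }) ((i ≟ k) ×-dec (j ≟ l))

H : (t : ℕ) → Graph (Hᵥ t)
H t = record
  { _~_      = λ x y → Link x y ⊎ Link y x
  ; ~-sym    = swap
  ; ~-irrefl = λ { refl (inj₁ l) → noLoop l ; refl (inj₂ l) → noLoop l }
  ; _~?_     = λ x y → link? x y ⊎-dec link? y x
  }
  where
  Link : Rel (Hᵥ t) 0ℓ
  Link x y = ∃₂ λ (i : Fin t) (j : Fin 4) → x ≡ glue i (inject₁ j) × y ≡ glue i (suc j)

  link? : Decidable Link
  link? x y = any? λ i → any? λ j → (x ≟ᴴ glue i (inject₁ j)) ×-dec (y ≟ᴴ glue i (suc j))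

  glue-step : ∀ (i : Fin t) j → glue i (inject₁ j) ≢ glue i (suc j)
  glue-step i 0F ()
  glue-step i 1F ()
  glue-step i 2F ()
  glue-step i 3F ()

  noLoop : ∀ {x} → ¬ Link x x
  noLoop (i , j , p , q) = glue-step i j (trans (sym p) q)

-- The added vertex is nothing.
U : {V : Set} → Graph V → Graph (Maybe V)
U {V} F = record
  { _~_      = Adj
  ; ~-sym    = λ {x} {y} → adj-sym x y
  ; ~-irrefl = λ { {just _} refl e → ~-irrefl refl e ; {nothing} refl () }
  ; _~?_     = adj?
  }
  where
  open Graph F

  Adj : Rel (Maybe V) 0ℓ
  Adj (just x) (just y) = x ~ y
  Adj (just _) nothing  = ⊤
  Adj nothing  (just _) = ⊤
  Adj nothing  nothing  = ⊥

  adj-sym : ∀ x y → Adj x y → Adj y x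
  adj-sym (just _) (just _) e = ~-sym e
  adj-sym (just _) nothing  _ = tt
  adj-sym nothing  (just _) _ = tt

  adj? : Decidable Adj
  adj? (just x) (just y) = x ~? y
  adj? (just _) nothing  = yes tt
  adj? nothing  (just _) = yes tt
  adj? nothing  nothing  = no λ ()

------------------------------------------------------------------------
-- Cops and robbers

module Game {V : Set} (G : Graph V) where
  open Graph G

  Move : Rel V 0ℓ
  Move = ReflClosure _~_

  -- A strategy for m cops: the positions of the cops as a function of the
  -- robber's positions so far, most recent first.  Thus position [] is the
  -- initial placement, made before the robber appears, and
  -- position (r ∷ rs) is the outcome of the cops' turn in response to r.
  record Strategy (m : ℕ) : Set where
    field
      position : List V → Vec V m
      legal    : ∀ r rs → Pointwise Move (position rs) (position (r ∷ rs))

  -- A robber play: the initial vertex and the vertex after each robber turn.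
  record RobberPlay : Set where
    field
      at    : ℕ → V
      legal : ∀ k → Move (at k) (at (suc k))

    history : ℕ → List V
    history zero    = []
    history (suc k) = at k ∷ history k

  -- The robber's k-th vertex is occupied either when the robber arrives there
  -- or after the cops' answering turn.
  Captures : ∀ {m} → Strategy m → RobberPlay → Set
  Captures σ ρ = ∃ λ k → (at k ∈ position (history k)) ⊎ (at k ∈ position (history (suc k)))
    where
    open Strategy σ using (position)
    open RobberPlay ρ using (at; history)

  CopsWin : ℕ → Set
  CopsWin m = Σ (Strategy m) λ σ → ∀ ρ → Captures σ ρ

IsCopNumber : {V : Set} → Graph V → ℕ → Set
IsCopNumber G c = CopsWin c × (∀ m → CopsWin m → c ≤ m)
  where open Game G

-- The robber is confined to a connected region R whose outer border is guarded.  Outside R lie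
-- two disjoint connected cores, each with at most one border vertex, and t + 1 disjoint paths
-- between them.  One cop guards the border vertices in the cores and on path 0, and one cop
-- guards those on each of the paths 1, …, t; the last cop is free.  If both cores meet the border
-- and each of the paths 1, …, t has at least three border vertices, then cutting every such path
-- into three segments and contracting R to the apex gives a U (H t) minor.  Otherwise some path
-- has at most two border vertices: the free cop guards a geodesic through R between these (or the
-- border vertices of the cores), this geodesic replaces the part of the path between its ends,
-- and once the path's own cop guards it too, the free cop is released.  When a core has no border
-- vertex, a piece of a path up to its first (or last) border vertex is absorbed into it; if this
-- is impossible, the border has at most one vertex, and one starts afresh.  Each time R strictly
-- shrinks.
module Submission where

open import Defs
open import Data.Bool using (Bool; true; false)
import Data.Bool.Properties as Boolₚ
open import Data.Empty using (⊥; ⊥-elim)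
open import Data.Fin using (Fin; zero; suc; punchIn; punchOut; _≟_; combine; remQuot; inject₁)
open import Data.Fin.Patterns using (0F; 1F; 2F; 3F)
open import Data.Fin.Properties using (any?; punchIn-punchOut; punchInᵢ≢i; punchIn-injective; all?; remQuot-combine)
open import Data.Fin.Subset as Subset using (Subset; _⊃_; ⁅_⁆; _∪_; _⊂_) renaming (_∈_ to _∈ˢ_; _∉_ to _∉ˢ_; _⊆_ to _⊆ˢ_)
open import Data.Fin.Subset.Induction using (⊃-wellFounded; ⊂-wellFounded)
import Data.Fin.Subset.Properties as Subsetₚ
open import Data.Fin.Subset.Properties using (_∈?_; ∈⊤)
open import Data.List using (List; []; _∷_; allFin; cartesianProduct; _++_)
open import Data.List.Membership.DecPropositional using () renaming (_∈?_ to member?)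
open import Data.List.Membership.Propositional using (_∈_)
open import Data.List.Membership.Propositional.Properties using (∈-cartesianProduct⁺; ∈-allFin; ∈-++⁺ˡ; ∈-++⁺ʳ; ∈-++⁻)
open import Data.List.Properties using (++-assoc; ++-identityʳ)
open import Data.List.Relation.Binary.Disjoint.Propositional using (Disjoint)
open import Data.List.Relation.Unary.All as All using ([]; _∷_)
open import Data.List.Relation.Unary.AllPairs using ([]; _∷_)
open import Data.List.Relation.Unary.Any using (here; there)
open import Data.List.Relation.Unary.Unique.Propositional using (Unique)
import Data.List.Relation.Unary.Unique.Propositional.Properties as Unique
open import Data.Maybe using (Maybe; just; nothing)
open import Data.Maybe.Properties using (just-injective; ≡-dec)
open import Data.Nat using (ℕ; zero; suc; _≤_; z≤n; s≤s; _^_; _+_; _⊔_; _≥_)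
open import Data.Nat.Properties using (≤-refl; ≤-trans; n≤1+n; m≤n⇒m<n∨m≡n; ≤-antisym; ≤-reflexive; ≤-pred; +-suc; +-identityʳ; m≤m⊔n; m≤n⊔m; <-irrefl; +-comm)
import Data.Nat.Properties as ℕₚ
open import Data.Product using (∃; ∃₂; _×_; _,_; proj₁; proj₂)
open import Data.Sum using (_⊎_; inj₁; inj₂; [_,_]′)
open import Data.Vec using (Vec; []; _∷_; lookup; tabulate)
open import Data.Vec.Functional using (updateAt)
open import Data.Vec.Functional.Properties using (updateAt-updates; updateAt-minimal)
open import Data.Vec.Membership.Propositional using () renaming (_∈_ to _∈ᵛ_)
open import Data.Vec.Membership.Propositional.Properties using (∈-lookup)
open import Data.Vec.Properties using (lookup∘tabulate; lookup⇒[]=; []=⇒lookup)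
open import Data.Vec.Relation.Binary.Pointwise.Inductive using (Pointwise; []; _∷_)
import Data.Vec.Relation.Binary.Pointwise.Inductive as Pointwise
open import Data.Vec.Relation.Unary.Any using (index)
open import Data.Vec.Relation.Unary.Any.Properties using (lookup-index)
open import Function using (_∘_; mk⇔; mk↔ₛ′; const)
open import Induction.WellFounded using (Acc; acc)
open import Relation.Binary using (DecidableEquality)
open import Relation.Binary.Construct.Closure.Reflexive using (refl; [_])
import Relation.Binary.Construct.Closure.Reflexive.Properties as Reflₚ
open import Relation.Binary.Construct.Closure.ReflexiveTransitive using (Star; ε; _◅_; _◅◅_; reverse)
import Relation.Binary.Construct.Closure.ReflexiveTransitive as Star
open import Relation.Binary.PropositionalEquality using (_≡_; _≢_; refl; sym; trans; cong; subst; subst₂)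
open import Relation.Nullary using (¬_; Dec; yes; no; contradiction; does)
open import Relation.Nullary.Decidable using (_×-dec_; ¬?; decidable-stable; _⊎-dec_; _→-dec_; map′; dec-true; ¬¬-excluded-middle)
open import Relation.Unary using (Decidable)

-- Minors from branch sets

-- The shape of `H t` dictates the constants. A path of `H t` has three inner vertices, each
-- adjacent to the apex, so three border vertices on a path pay for one path of the minor. With at
-- most two of them, a geodesic can take over, because it has two ends to which its guard extends.
-- For the same reason a core may have only one border vertex: a geodesic between the border
-- vertices of the two cores lets a single cop protect both of them together with path 0. A guard is
-- a map from robber positions to cop positions whose fixed points are the protected vertices. Its
-- defining condition concerns only robber moves out of vertices of `R`, so it survives every later
-- shrinking of `R`. The conclusion produces the cop number itself, minimality included, so the game
-- has to be decided. Decidability of winning positions has a second use: winning becomes stable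
-- under double negation, which allows classical reasoning about components of the region.

Within : ∀ {V} → Graph V → (V → Set) → V → V → Set
Within G P = Star (λ x y → Graph._~_ G x y × P x × P y)

ConnectedOn : ∀ {V} → Graph V → (V → Set) → Set
ConnectedOn G P = ∀ {x y} → P x → P y → Within G P x y

-- The branch set of w is the set of vertices labelled just w.
record Model {W : Set} {n : ℕ} (G : Graph (Fin n)) (K : Graph W) : Set where
  field
    label     : Fin n → Maybe W
    inhabited : ∀ w → ∃ λ x → label x ≡ just w
    connected : ∀ w → ConnectedOn G (λ x → label x ≡ just w)
    edge      : ∀ {w w′} → Graph._~_ K w w′ →
                ∃₂ λ x y → label x ≡ just w × label y ≡ just w′ × Graph._~_ G x y

module _ {W : Set} (_≟ʷ_ : DecidableEquality W) (K : Graph W) where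
  private
    module K = Graph K

  -- The pairs in ps are those that may still have to be deleted.
  isomorphicAfterDeletions : ∀ {n} (G : Graph (Fin n)) (to : Fin n → W) (from : W → Fin n) →
    (∀ w → to (from w) ≡ w) → (∀ x → from (to x) ≡ x) →
    (∀ x y → to x K.~ to y → Graph._~_ G x y) →
    (ps : List (Fin n × Fin n)) →
    (∀ x y → Graph._~_ G x y → ¬ (to x K.~ to y) → (x , y) ∈ ps) →
    HasMinor G K
  isomorphicAfterDeletions G to from to-from from-to reflects [] extra = isomorphic record
    { bijection = mk↔ₛ′ to from to-from from-to
    ; preserves = λ x y → mk⇔ (λ e → decidable-stable (to x K.~? to y) λ ne → case-[] (extra x y e ne))
                              (reflects x y)
    }
    where
    case-[] : ∀ {p} → p ∈ [] → ⊥
    case-[] ()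
  isomorphicAfterDeletions {n} G to from to-from from-to reflects ((u , v) ∷ ps) extra
    with Graph._~?_ G u v ×-dec ¬? (to u K.~? to v)
  ... | no ¬extra = isomorphicAfterDeletions G to from to-from from-to reflects ps extra′
    where
    extra′ : ∀ x y → Graph._~_ G x y → ¬ (to x K.~ to y) → (x , y) ∈ ps
    extra′ x y e ne with extra x y e ne
    ... | here refl = contradiction (e , ne) ¬extra
    ... | there p   = p
  ... | yes (e , ne) = by-deleteEdge u v e
    (isomorphicAfterDeletions (deleteEdge G u v) to from to-from from-to reflects′ ps extra′)
    where
    reflects′ : ∀ x y → to x K.~ to y → Graph._~_ (deleteEdge G u v) x y
    reflects′ x y k = reflects x y k , λ
      { (inj₁ (refl , refl)) → ne k
      ; (inj₂ (refl , refl)) → ne (K.~-sym k) }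
    extra′ : ∀ x y → Graph._~_ (deleteEdge G u v) x y → ¬ (to x K.~ to y) → (x , y) ∈ ps
    extra′ x y (e′ , ¬uv) ne′ with extra x y e′ ne′
    ... | here refl = contradiction (inj₁ (refl , refl)) ¬uv
    ... | there p   = p

  module _ {n : ℕ} {G : Graph (Fin n)} (M : Model G K) where
    open Graph G
    open Model M

    discreteModel⇒HasMinor : (∀ x → label x ≢ nothing) →
      (∀ x y → x ~ y → label x ≢ label y) → HasMinor G K
    discreteModel⇒HasMinor total proper =
      isomorphicAfterDeletions G to from to-from from-to reflects
        (cartesianProduct (allFin n) (allFin n))
        (λ x y _ _ → ∈-cartesianProduct⁺ (∈-allFin x) (∈-allFin y))
      where
      labelled : ∀ x → ∃ λ w → label x ≡ just w
      labelled x with label x in eq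
      ... | just w  = w , refl
      ... | nothing = contradiction eq (total x)
      to : Fin n → W
      to = proj₁ ∘ labelled
      from : W → Fin n
      from = proj₁ ∘ inhabited
      to-from : ∀ w → to (from w) ≡ w
      to-from w = just-injective (trans (sym (proj₂ (labelled (from w)))) (proj₂ (inhabited w)))
      injective : ∀ {w x y} → label x ≡ just w → label y ≡ just w → x ≡ y
      injective p q with connected _ p q
      ... | ε = refl
      ... | (e , j₁ , j₂) ◅ _ = contradiction (trans j₁ (sym j₂)) (proper _ _ e)
      from-to : ∀ x → from (to x) ≡ x
      from-to x = injective (proj₂ (inhabited (to x))) (proj₂ (labelled x))
      reflects : ∀ x y → to x K.~ to y → x ~ y
      reflects x y k with edge k
      ... | x′ , y′ , p , q , e =
        subst₂ _~_ (injective p (proj₂ (labelled x))) (injective q (proj₂ (labelled y))) e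

  restrictModel : ∀ {n} {G : Graph (Fin (suc n))} (M : Model G K) (v : Fin (suc n)) →
    Model.label M v ≡ nothing → Model (deleteVertex G v) K
  restrictModel {n} {G} M v unlabelled = record
    { label     = label ∘ punchIn v
    ; inhabited = λ w → let (x , p) = inhabited w in
                    punchOut (v≢ p) , trans (cong label (punchIn-punchOut (v≢ p))) p
    ; connected = λ w p q → lift refl refl p (connected w p q)
    ; edge      = λ k → let (x , y , p , q , e) = edge k in
                    punchOut (v≢ p) , punchOut (v≢ q) ,
                    trans (cong label (punchIn-punchOut (v≢ p))) p ,
                    trans (cong label (punchIn-punchOut (v≢ q))) q ,
                    subst₂ _~_ (sym (punchIn-punchOut (v≢ p))) (sym (punchIn-punchOut (v≢ q))) e
    }
    where
    open Graph G
    open Model M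
    v≢ : ∀ {x w} → label x ≡ just w → v ≢ x
    v≢ p refl with trans (sym unlabelled) p
    ... | ()
    lift : ∀ {w x y x′ y′} → punchIn v x′ ≡ x → punchIn v y′ ≡ y → label x ≡ just w →
      Within G (λ z → label z ≡ just w) x y →
      Within (deleteVertex G v) (λ z → label (punchIn v z) ≡ just w) x′ y′
    lift {x′ = x′} {y′} p q l ε with punchIn-injective v x′ y′ (trans p (sym q))
    ... | refl = ε
    lift p q l (_◅_ {j = z} (e , j₁ , j₂) s) =
      (subst₂ _~_ (sym p) (sym (punchIn-punchOut (v≢ j₂))) e
        , trans (cong label p) j₁
        , trans (cong label (punchIn-punchOut (v≢ j₂))) j₂)
      ◅ lift (punchIn-punchOut (v≢ j₂)) q j₂ s

  contractModel : ∀ {n} {G : Graph (Fin (suc n))} (M : Model G K) (u v : Fin (suc n)) (v≢u : v ≢ u) →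
    Model.label M u ≡ Model.label M v → Model (contract G u v v≢u) K
  contractModel {n} {G} M u v v≢u same = record
    { label     = label′
    ; inhabited = λ w → let (x , p) = inhabited w in π x , trans (label-π x) p
    ; connected = λ w {x} {y} p q → subst₂ (Within (contract G u v v≢u) (λ z → label′ z ≡ just w))
                    (π-punchIn x) (π-punchIn y) (project (connected w p q))
    ; edge      = λ k → let (x , y , p , q , e) = edge k in
                    π x , π y , trans (label-π x) p , trans (label-π y) q ,
                    -- The contraction drops loops; the two images differ because their labels do,
                    -- `K` being loopless.
                    (λ πx≡πy → K.~-irrefl (just-injective (trans (sym p)
                      (trans (sym (label-π x)) (trans (cong label′ πx≡πy) (trans (label-π y) q))))) k) ,
                    x , y , refl , refl , e
    }
    where
    open Graph G
    open Model M
    π : Fin (suc n) → Fin n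
    π = merge u v v≢u
    label′ : Fin n → Maybe W
    label′ = label ∘ punchIn v
    label-π : ∀ x → label′ (π x) ≡ label x
    label-π x with v ≟ x
    ... | yes refl = trans (cong label (punchIn-punchOut v≢u)) same
    ... | no v≢x   = cong label (punchIn-punchOut v≢x)
    π-punchIn : ∀ x → π (punchIn v x) ≡ x
    π-punchIn x with v ≟ punchIn v x
    ... | yes p  = contradiction (sym p) (punchInᵢ≢i v x)
    ... | no v≢x = punchIn-injective v _ _ (punchIn-punchOut v≢x)
    project : ∀ {w x y} → Within G (λ z → label z ≡ just w) x y →
      Within (contract G u v v≢u) (λ z → label′ z ≡ just w) (π x) (π y)
    project ε = ε
    project (_◅_ {i = x} {j = z} (e , j₁ , j₂) s) with π x ≟ π z
    ... | yes p rewrite p = project s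
    ... | no πx≢πz =
      ((πx≢πz , x , z , refl , refl , e) , trans (label-π x) j₁ , trans (label-π z) j₂) ◅ project s

  -- A vertex outside all branch sets is deleted and an edge inside one is contracted; either lowers
  -- `n`. When neither exists the model is discrete.
  model⇒HasMinor : ∀ {n} {G : Graph (Fin n)} → Model G K → HasMinor G K
  model⇒HasMinor {zero} M = discreteModel⇒HasMinor M (λ ()) (λ ())
  model⇒HasMinor {suc n} {G} M with any? (λ x → ≡-dec _≟ʷ_ (Model.label M x) nothing)
  ... | yes (v , p) = by-deleteVertex v (model⇒HasMinor (restrictModel M v p))
  ... | no total with any? (λ x → any? λ y →
                      Graph._~?_ G x y ×-dec ≡-dec _≟ʷ_ (Model.label M x) (Model.label M y))
  ...   | yes (u , v , e , same) =
          by-contract u v e v≢u (model⇒HasMinor (contractModel M u v v≢u same))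
    where
    v≢u : v ≢ u
    v≢u v≡u = Graph.~-irrefl G (sym v≡u) e
  ...   | no proper =
          discreteModel⇒HasMinor M (λ x p → total (x , p)) (λ x y e p → proper (x , y , e , p))

-- Deciding the game

least : ∀ {P : ℕ → Set} → Decidable P → ∀ {m} → P m →
  ∃ λ k → P k × k ≤ m × (∀ {j} → P j → k ≤ j)
least P? {zero} p = zero , p , z≤n , λ _ → z≤n
least {P} P? {suc m} p with P? zero
... | yes p₀ = zero , p₀ , z≤n , λ _ → z≤n
... | no ¬p₀ with least (P? ∘ suc) p
...   | k , q , k≤m , min = suc k , q , s≤s k≤m , min′
  where
  min′ : ∀ {j} → P j → suc k ≤ j
  min′ {zero}  p₀ = contradiction p₀ ¬p₀
  min′ {suc j} p  = s≤s (min p)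

anyVec? : ∀ {n} m {P : Vec (Fin n) m → Set} → Decidable P → Dec (∃ P)
anyVec? zero    P? = map′ ([] ,_) (λ { ([] , p) → p }) (P? [])
anyVec? (suc m) P? = map′ (λ (x , xs , p) → x ∷ xs , p) (λ { (x ∷ xs , p) → x , xs , p })
  (any? λ x → anyVec? m λ xs → P? (x ∷ xs))

encode : ∀ {n m} → Vec (Fin n) m → Fin (n ^ m)
encode []       = zero
encode (x ∷ xs) = combine x (encode xs)

decode : ∀ {n} m → Fin (n ^ m) → Vec (Fin n) m
decode         zero    _ = []
decode {n} (suc m) i = let (x , j) = remQuot (n ^ m) i in x ∷ decode m j

decode-encode : ∀ {n m} (xs : Vec (Fin n) m) → decode m (encode xs) ≡ xs
decode-encode []               = refl
decode-encode {n} {suc m} (x ∷ xs) =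
  trans (cong (λ (y , j) → y ∷ decode m j) (remQuot-combine {n} {n ^ m} x (encode xs)))
        (cong (x ∷_) (decode-encode xs))

-- Adding the elements forced by a decidable rule until none is left.
saturate : ∀ {N} {Rule : Subset N → Fin N → Set} → (∀ S x → Dec (Rule S x)) →
  {Good : Fin N → Set} → (∀ S → (∀ {x} → x Subset.∈ S → Good x) → ∀ {x} → Rule S x → Good x) →
  ∃ λ S → (∀ {x} → x Subset.∈ S → Good x) × (∀ {x} → Rule S x → x Subset.∈ S)
saturate {N} {Rule} rule? {Good} sound =
  go Subset.⊥ (⊃-wellFounded _) (λ x∈⊥ → contradiction x∈⊥ Subsetₚ.∉⊥)
  where
  go : ∀ S → Acc _⊃_ S → (∀ {x} → x Subset.∈ S → Good x) →
    ∃ λ S → (∀ {x} → x Subset.∈ S → Good x) × (∀ {x} → Rule S x → x Subset.∈ S)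
  go S (acc rec) good with any? (λ x → ¬? (x Subsetₚ.∈? S) ×-dec rule? S x)
  ... | no closed = S , good , λ {x} r → decidable-stable (x Subsetₚ.∈? S) λ x∉S → closed (x , x∉S , r)
  ... | yes (x , x∉S , r) = go (S ∪ ⁅ x ⁆)
    (rec (Subsetₚ.p⊆p∪q ⁅ x ⁆ , x , Subsetₚ.x∈p∪q⁺ (inj₂ (Subsetₚ.x∈⁅x⁆ x)) , x∉S))
    λ {y} y∈ → [ good , (λ y∈x → subst Good (sym (Subsetₚ.x∈⁅y⁆⇒x≡y x y∈x)) (sound S good r)) ]′
               (Subsetₚ.x∈p∪q⁻ S ⁅ x ⁆ y∈)

module Pursuit {n : ℕ} (G : Graph (Fin n)) where
  open Graph G
  open Game G using (Move; Strategy; RobberPlay; Captures; CopsWin)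

  Moves : ∀ {m} → (Fin m → Fin n) → (Fin m → Fin n) → Set
  Moves c c′ = ∀ j → Move (c j) (c′ j)

  -- The cops have just moved and it is the robber's turn.
  data Win {m : ℕ} (c : Fin m → Fin n) (r : Fin n) : Set where
    caught : ∀ j → c j ≡ r → Win c r
    chase  : (∀ r′ → Move r r′ → ∃ λ c′ → Moves c c′ × Win c′ r′) → Win c r

  move? : ∀ x y → Dec (Move x y)
  move? = Reflₚ.dec _≟_ _~?_

  moves? : ∀ {m} (c c′ : Fin m → Fin n) → Dec (Moves c c′)
  moves? c c′ = all? λ j → move? (c j) (c′ j)

  Win-resp : ∀ {m} {c c′ : Fin m → Fin n} {r} → (∀ j → c j ≡ c′ j) → Win c r → Win c′ r
  Win-resp eq (caught j p) = caught j (trans (sym (eq j)) p)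
  Win-resp eq (chase f)    = chase λ r′ s → let (d , ms , w) = f r′ s in
    d , (λ j → subst (λ x → Move x (d j)) (eq j) (ms j)) , w

  module _ {m : ℕ} where
    private
      -- One unfolding of `Win`, with membership in `S` in place of the recursive occurrence;
      -- saturating from the empty set yields its least fixed point.
      Rule : Subset (n ^ suc m) → Vec (Fin n) (suc m) → Set
      Rule S (r ∷ c) = (∃ λ j → lookup c j ≡ r) ⊎
        (∀ r′ → Move r r′ → ∃ λ c′ → Moves (lookup c) (lookup c′) × encode (r′ ∷ c′) Subset.∈ S)

      rule? : ∀ S v → Dec (Rule S v)
      rule? S (r ∷ c) = any? (λ j → lookup c j ≟ r) ⊎-dec
        all? λ r′ → move? r r′ →-dec anyVec? m λ c′ →
          moves? (lookup c) (lookup c′) ×-dec (encode (r′ ∷ c′) Subsetₚ.∈? S)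

      Good : Vec (Fin n) (suc m) → Set
      Good (r ∷ c) = Win (lookup c) r

      sound : ∀ S → (∀ {x} → x Subset.∈ S → Good (decode (suc m) x)) → ∀ v → Rule S v → Good v
      sound S good (r ∷ c) (inj₁ (j , p)) = caught j p
      sound S good (r ∷ c) (inj₂ f)       = chase λ r′ s → let (c′ , ms , w) = f r′ s in
        lookup c′ , ms , subst Good (decode-encode (r′ ∷ c′)) (good w)

      saturated : ∃ λ S → (∀ {x} → x Subset.∈ S → Good (decode (suc m) x)) ×
                          (∀ {x} → Rule S (decode (suc m) x) → x Subset.∈ S)
      saturated = saturate (λ S x → rule? S (decode (suc m) x)) (λ S good {x} → sound S good (decode (suc m) x))

      winning : Subset (n ^ suc m)
      winning = proj₁ saturated

      -- Induction on the winning derivation, one application of the closure of `winning` per round.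
      -- Positions are functions, so the vector `v` represents `c` up to pointwise equality.
      complete : ∀ {c r} → Win c r → ∀ v → (∀ j → c j ≡ lookup v j) → encode (r ∷ v) Subset.∈ winning
      complete {c} {r} w v eq =
        proj₂ (proj₂ saturated) (subst (Rule winning) (sym (decode-encode (r ∷ v))) (rule w))
        where
        rule : Win c r → Rule winning (r ∷ v)
        rule (caught j p) = inj₁ (j , trans (sym (eq j)) p)
        rule (chase f) = inj₂ λ r′ s → let (c′ , ms , w′) = f r′ s in
          tabulate c′ , (λ j → subst₂ Move (eq j) (sym (lookup∘tabulate c′ j)) (ms j)) ,
          complete w′ (tabulate c′) (λ j → sym (lookup∘tabulate c′ j))

    win? : (c : Fin m → Fin n) (r : Fin n) → Dec (Win c r)
    win? c r = map′
      (λ w → Win-resp (lookup∘tabulate c)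
               (subst Good (decode-encode (r ∷ tabulate c)) (proj₁ (proj₂ saturated) w)))
      (λ w → complete w (tabulate c) (λ j → sym (lookup∘tabulate c j)))
      (encode (r ∷ tabulate c) Subsetₚ.∈? winning)

  Reply : ∀ {m} → (Fin m → Fin n) → Fin n → Set
  Reply c r = ∃ λ c′ → Moves c c′ × Win c′ r

  reply? : ∀ {m} (c : Fin m → Fin n) r → Dec (Reply c r)
  reply? {m} c r = map′
    (λ (v , ms , w) → lookup v , ms , w)
    (λ (c′ , ms , w) → tabulate c′ ,
       (λ j → subst (Move (c j)) (sym (lookup∘tabulate c′ j)) (ms j)) ,
       Win-resp (λ j → sym (lookup∘tabulate c′ j)) w)
    (anyVec? m λ v → moves? c (lookup v) ×-dec win? (lookup v) r)

  module _ {m : ℕ} where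

    -- A strategy must answer every history, even one that no robber can produce. The winning
    -- derivation is carried along while the moves are legal; `over` is the default after a capture
    -- or an illegal move, and there the cops stand still.
    data Situation (c : Fin m → Fin n) : Set where
      start : (∀ r → Reply c r) → Situation c
      live  : ∀ r → Win c r → Situation c
      over  : Situation c

    respond : ∀ {c} → Situation c → Fin n → ∃ λ c′ → Moves c c′ × Situation c′
    respond (start f) r = let (c′ , ms , w) = f r in c′ , ms , live r w
    respond (live r₀ (caught _ _)) r = _ , (λ _ → refl) , over
    respond (live r₀ (chase f)) r with move? r₀ r
    ... | yes s = let (c′ , ms , w) = f r s in c′ , ms , live r w
    ... | no _  = _ , (λ _ → refl) , over
    respond over r = _ , (λ _ → refl) , over

    next : ∃ Situation → Fin n → ∃ Situation
    next (_ , s) r = let (c′ , _ , s′) = respond s r in c′ , s′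

    next-live : ∀ {c r₀ r} (f : ∀ r′ → Move r₀ r′ → Reply c r′) → Move r₀ r →
      ∃ λ s → next (c , live r₀ (chase f)) r ≡ (proj₁ (f r s) , live r (proj₂ (proj₂ (f r s))))
    next-live {r₀ = r₀} {r} f s with move? r₀ r
    ... | yes s′ = s′ , refl
    ... | no ¬s  = contradiction s ¬s

    replies⇒CopsWin : (c : Fin m → Fin n) → (∀ r → Reply c r) → CopsWin m
    replies⇒CopsWin c f = σ , λ ρ →
      let module ρ = RobberPlay ρ
          (c′ , _ , w) = f (ρ.at 0)
      in wins ρ 0 w refl
      where
      run : List (Fin n) → ∃ Situation
      run []       = c , start f
      run (r ∷ rs) = next (run rs) r

      pointwise : ∀ {k} {c c′ : Fin k → Fin n} → Moves c c′ → Pointwise Move (tabulate c) (tabulate c′)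
      pointwise {zero}  _ = []
      pointwise {suc _} m = m zero ∷ pointwise (m ∘ suc)

      σ : Strategy m
      σ = record
        { position = tabulate ∘ proj₁ ∘ run
        ; legal    = λ r rs → pointwise (proj₁ (proj₂ (respond (proj₂ (run rs)) r)))
        }

      wins : (ρ : RobberPlay) → let open RobberPlay ρ in
        ∀ k {c} (w : Win c (at k)) → run (history (suc k)) ≡ (c , live (at k) w) → Captures σ ρ
      wins ρ k (caught j p) eq = k , inj₂ (subst (_∈ᵛ Strategy.position σ (history (suc k)))
        (trans (lookup∘tabulate (proj₁ (run (history (suc k)))) j)
               (trans (cong (λ s → proj₁ s j) eq) p))
        (∈-lookup j (tabulate (proj₁ (run (history (suc k)))))))
        where open RobberPlay ρ
      wins ρ k {c} (chase f) eq =
        let (s , eq′) = next-live f (RobberPlay.legal ρ k)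
        in wins ρ (suc k) (proj₂ (proj₂ (f _ s)))
             (trans (cong (λ x → next x (RobberPlay.at ρ (suc k))) eq) eq′)

    escape : ∀ {c : Fin m → Fin n} {r} → ¬ Win c r → ∃ λ r′ → Move r r′ × ¬ Reply c r′
    escape {c} {r} ¬w with any? (λ r′ → move? r r′ ×-dec ¬? (reply? c r′))
    ... | yes e = e
    ... | no ¬e = contradiction
      (chase λ r′ s → decidable-stable (reply? c r′) λ ¬w′ → ¬e (r′ , s , ¬w′)) ¬w

    -- If some initial robber vertex had no winning reply, the robber could step forever from one
    -- position without a winning reply to the next, whatever the strategy does, and would never be
    -- captured.
    CopsWin⇒replies : CopsWin m → ∃ λ (c : Vec (Fin n) m) → ∀ r → Reply (lookup c) r
    CopsWin⇒replies (σ , wins) = position [] ,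
      λ r → decidable-stable (reply? (lookup (position [])) r) λ ¬w → evade r ¬w
      where
      open Strategy σ

      Safe : Set
      Safe = ∃₂ λ hs r → ¬ Reply (lookup (position hs)) r

      ¬win : ((hs , r , _) : Safe) → ¬ Win (lookup (position (r ∷ hs))) r
      ¬win (hs , r , ¬w) w = ¬w (_ , (λ j → Pointwise.lookup (legal r hs) j) , w)

      advance : Safe → Safe
      advance s@(hs , r , _) = let (r′ , _ , ¬w) = escape (¬win s) in r ∷ hs , r′ , ¬w

      evade : ∀ r → ¬ Reply (lookup (position [])) r → ⊥
      evade r ¬w = uncaught (wins ρ)
        where
        safe : ℕ → Safe
        safe zero    = [] , r , ¬w
        safe (suc k) = advance (safe k)
        ρ : RobberPlay
        ρ = record
          { at    = λ k → proj₁ (proj₂ (safe k))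
          ; legal = λ k → proj₁ (proj₂ (escape (¬win (safe k))))
          }
        open RobberPlay ρ using (at; history)
        history≡ : ∀ k → history k ≡ proj₁ (safe k)
        history≡ zero    = refl
        history≡ (suc k) = cong (at k ∷_) (history≡ k)
        on-cop : ∀ {r} {v : Vec (Fin n) m} → r ∈ᵛ v → ∃ λ j → lookup v j ≡ r
        on-cop p = index p , sym (lookup-index p)
        uncaught : ¬ Captures σ ρ
        -- Had the robber stepped onto a cop, standing still would be a winning reply.
        uncaught (k , inj₁ p) rewrite history≡ k = let (j , q) = on-cop p in
          proj₂ (proj₂ (safe k)) (_ , (λ _ → refl) , caught j q)
        uncaught (k , inj₂ p) rewrite history≡ k = let (j , q) = on-cop p in
          ¬win (safe k) (caught j q)

    copsWin? : Dec (CopsWin m)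
    copsWin? = map′ (λ (c , f) → replies⇒CopsWin (lookup c) f) CopsWin⇒replies
      (anyVec? m λ c → all? λ r → reply? (lookup c) r)

  copNumber≤ : ∀ {m} → CopsWin m → ∃ λ c → IsCopNumber G c × c ≤ m
  copNumber≤ w = let (c , wins , c≤m , min) = least (λ m → copsWin? {m}) w in
    c , (wins , λ _ → min) , c≤m

-- Guarding and confining the robber

-- Finitely many double-negated instances of excluded middle combine into one.
¬¬-decidable : ∀ {n} (P : Fin n → Set) → ¬ ¬ (∀ x → Dec (P x))
¬¬-decidable {zero}  P k = k λ ()
¬¬-decidable {suc n} P k = ¬¬-excluded-middle λ d₀ → ¬¬-decidable (P ∘ suc) λ d →
  k λ { zero → d₀ ; (suc x) → d x }

bounded : ∀ {n} (f : Fin n → ℕ) → ∃ λ l → ∀ x → f x ≤ l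
bounded {zero}  f = zero , λ ()
bounded {suc n} f = let (l , bd) = bounded (f ∘ suc) in
  f zero ⊔ l , λ { zero → m≤m⊔n _ _ ; (suc x) → ≤-trans (bd x) (m≤n⊔m (f zero) l) }

module _ {n : ℕ} {P : Fin n → Set} (P? : ∀ x → Dec (P x)) where

  comprehension : Subset n
  comprehension = tabulate (does ∘ P?)

  ∈-comprehension⁺ : ∀ {x} → P x → x ∈ˢ comprehension
  ∈-comprehension⁺ {x} p = lookup⇒[]= x _ (trans (lookup∘tabulate _ x) (dec-true (P? x) p))

  ∈-comprehension⁻ : ∀ {x} → x ∈ˢ comprehension → P x
  ∈-comprehension⁻ {x} x∈ with P? x | trans (sym (lookup∘tabulate (does ∘ P?) x)) ([]=⇒lookup x∈)
  ... | yes p | _  = p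
  ... | no _  | ()

module Guarding {n : ℕ} (G : Graph (Fin n)) (G-connected : Connected G) where
  open Graph G
  open Game G using (Move)
  open Pursuit G

  private
    V = Fin n

  move-sym : ∀ {x y} → Move x y → Move y x
  move-sym = Reflₚ.sym ~-sym

  Border : Subset n → V → Set
  Border R v = v ∉ˢ R × ∃ λ u → u ∈ˢ R × u ~ v

  border? : ∀ R v → Dec (Border R v)
  border? R v = ¬? (v ∈? R) ×-dec any? λ u → (u ∈? R) ×-dec (u ~? v)

  -- While the robber moves inside R, a cop following g covers the fixed points of g.
  Guards : Subset n → (V → V) → Set
  Guards R g = ∀ {r r′} → r ∈ˢ R → r ~ r′ → r′ ∈ˢ R ⊎ g r′ ≡ r′ → Move (g r) (g r′)

  Guards-⊆ : ∀ {R R′ g} → R′ ⊆ˢ R → Guards R g → Guards R′ g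
  Guards-⊆ R′⊆R guards r∈ e (inj₁ r′∈) = guards (R′⊆R r∈) e (inj₁ (R′⊆R r′∈))
  Guards-⊆ R′⊆R guards r∈ e (inj₂ eq)  = guards (R′⊆R r∈) e (inj₂ eq)

  -- A guard moving along the walk p; a cop starting at p 0 can catch up with it.
  record Track (R : Subset n) : Set where
    field
      p       : ℕ → V
      f       : V → ℕ
      p-step  : ∀ k → Move (p k) (p (suc k))
      f-lip   : ∀ {r r′} → r ∈ˢ R → r′ ∈ˢ R → r ~ r′ → f r ≤ suc (f r′)
      exit    : ∀ {r r′} → r ∈ˢ R → r′ ∉ˢ R → r ~ r′ → p (f r′) ≡ r′ → Move (p (f r)) r′

    guard : V → V
    guard = p ∘ f

    guards : Guards R guard
    guards {r} {r′} r∈ e h with r′ ∈? R | h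
    ... | no r′∉ | inj₁ r′∈ = contradiction r′∈ r′∉
    ... | no r′∉ | inj₂ eq  = subst (Move (guard r)) (sym eq) (exit r∈ r′∉ e eq)
    -- By `f-lip` in both directions the two indices differ by at most one, so the guard makes at
    -- most one step along `p`.
    ... | yes r′∈ | _ with m≤n⇒m<n∨m≡n (f-lip r∈ r′∈ e) | m≤n⇒m<n∨m≡n (f-lip r′∈ r∈ (~-sym e))
    ...   | inj₂ eq | _ = subst (λ k → Move (p k) (guard r′)) (sym eq) (move-sym (p-step _))
    ...   | inj₁ _  | inj₂ eq = subst (λ k → Move (guard r) (p k)) (sym eq) (p-step _)
    ...   | inj₁ l  | inj₁ l′ = subst (λ k → Move (guard r) (p k)) (≤-antisym (≤-pred l) (≤-pred l′)) refl

  module _ {m : ℕ} {R : Subset n} (g : Fin m → V → V) (guards : ∀ j → Guards R (g j)) (i : Fin m)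
           (cover : ∀ {v} → Border R v → ∃ λ j → j ≢ i × g j v ≡ v) where

    private
      pos : V → V → Fin m → V
      pos x r = updateAt (λ j → g j r) i (const x)

      at-i : ∀ {c : Fin m → V} {x} → updateAt c i (const x) i ≡ x
      at-i {c} = updateAt-updates i c

      off-i : ∀ {c : Fin m → V} {x j} → j ≢ i → updateAt c i (const x) j ≡ c j
      off-i {c} {j = j} j≢i = updateAt-minimal j i c j≢i

      -- A robber leaving `R` enters a border vertex fixed by the guard of a cop other than `i` and
      -- is captured at once. Cop `i` is therefore free to move while the robber stays in `R`.
      round : ∀ {x r} → r ∈ˢ R →
        (∀ {r′} → r′ ∈ˢ R → Move r r′ → ∃ λ x′ → Move x x′ × Win (pos x′ r′) r′) → Win (pos x r) r
      round {x} {r} r∈ continue = chase reply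
        where
        inside : ∀ {r′} → r′ ∈ˢ R → Move r r′ → Reply (pos x r) r′
        inside {r′} r′∈ s = let (x′ , s′ , w) = continue r′∈ s in pos x′ r′ , moves s′ , w
          where
          follow : ∀ {j r′} → Move r r′ → r′ ∈ˢ R → Move (g j r) (g j r′)
          follow refl  _   = refl
          follow [ e ] r′∈ = guards _ r∈ e (inj₁ r′∈)
          moves : ∀ {x′} → Move x x′ → Moves (pos x r) (pos x′ r′)
          moves s′ j with j ≟ i
          ... | yes refl = subst₂ Move (sym at-i) (sym at-i) s′
          ... | no j≢i   = subst₂ Move (sym (off-i j≢i)) (sym (off-i j≢i)) (follow s r′∈)
        reply : ∀ r′ → Move r r′ → Reply (pos x r) r′
        reply r′ s with r′ ∈? R | s
        ... | yes r′∈ | _     = inside r′∈ s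
        ... | no r′∉  | refl  = contradiction r∈ r′∉
        ... | no r′∉  | [ e ] with cover (r′∉ , r , r∈ , e)
        ...   | j , j≢i , fix = updateAt (pos x r) j (const r′) , moves ,
                                caught j (updateAt-updates j (pos x r))
          where
          moves : Moves (pos x r) (updateAt (pos x r) j (const r′))
          moves k with k ≟ j
          ... | yes refl = subst₂ Move (sym (off-i j≢i)) (trans fix (sym (updateAt-updates j (pos x r))))
                             (guards j r∈ e (inj₂ fix))
          ... | no k≢j   = subst (Move (pos x r k)) (sym (updateAt-minimal k j (pos x r) k≢j)) refl

    -- Cop `i` walks to `p 0` and then climbs `p`, keeping its index at most `f r`. A robber move
    -- lowers `f` by at most one, so a cop strictly behind is never overtaken, and it waits when the
    -- indices have become equal. As `f` is bounded, they do become equal.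
    acquire : (T : Track R) →
      (∀ {r} → r ∈ˢ R → Win (λ j → updateAt g i (const (Track.guard T)) j r) r) →
      ∀ {r} → r ∈ˢ R → Win (λ j → g j r) r
    acquire T done {r} r∈ = Win-resp resp (walk (G-connected (g i r) (p 0)) r∈)
      where
      open Track T
      resp : ∀ j → pos (g i r) r j ≡ g j r
      resp j with j ≟ i
      ... | yes refl = at-i
      ... | no j≢i   = off-i j≢i
      done′ : ∀ {r} → r ∈ˢ R → Win (pos (guard r) r) r
      done′ {r} r∈ = Win-resp eq (done r∈)
        where
        eq : ∀ j → updateAt g i (const guard) j r ≡ pos (guard r) r j
        eq j with j ≟ i
        ... | yes refl = trans (cong (λ h → h r) (updateAt-updates i g)) (sym at-i)
        ... | no j≢i   = trans (cong (λ h → h r) (updateAt-minimal j i g j≢i)) (sym (off-i j≢i))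
      l : ℕ
      l = proj₁ (bounded f)
      -- The fuel `d` bounds the steps left until the index reaches the maximum `l` of `f`.
      catchUp : ∀ d j → l ≤ j + d → ∀ {r} → j ≤ f r → r ∈ˢ R → Win (pos (p j) r) r
      catchUp d j l≤ {r} j≤ r∈ with m≤n⇒m<n∨m≡n j≤
      ... | inj₂ refl = done′ r∈
      catchUp zero j l≤ {r} _ r∈ | inj₁ j<
        = contradiction (≤-trans j< (≤-trans (proj₂ (bounded f) r) (≤-trans l≤ (≤-reflexive (+-identityʳ j))))) (<-irrefl refl)
      catchUp (suc d) j l≤ {r} _ r∈ | inj₁ j< = round r∈ λ r′∈ s → advance r′∈ (behind s r′∈)
        where
        behind : ∀ {r′} → Move r r′ → r′ ∈ˢ R → j ≤ f r′
        behind refl  _   = ≤-pred (≤-trans j< (n≤1+n _))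
        behind [ e ] r′∈ = ≤-pred (≤-trans j< (f-lip r∈ r′∈ e))
        advance : ∀ {r′} → r′ ∈ˢ R → j ≤ f r′ → ∃ λ x′ → Move (p j) x′ × Win (pos x′ r′) r′
        advance r′∈ j≤ with m≤n⇒m<n∨m≡n j≤
        ... | inj₂ refl = p j , refl , done′ r′∈
        ... | inj₁ j<′  = p (suc j) , p-step j ,
                          catchUp d (suc j) (≤-trans l≤ (≤-reflexive (+-suc j d))) j<′ r′∈
      walk : ∀ {x} → Star _~_ x (p 0) → ∀ {r} → r ∈ˢ R → Win (pos x r) r
      walk ε r∈ = catchUp l 0 ≤-refl z≤n r∈
      walk (e ◅ es) r∈ = round r∈ λ r′∈ _ → _ , [ e ] , walk es r′∈

  within-sym : ∀ {P : V → Set} {x y} → Within G P x y → Within G P y x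
  within-sym = reverse λ (e , p , q) → ~-sym e , q , p

  within-stays : ∀ {P : V → Set} {r x y} → Within G P r x → Within G P x y → Within G (Within G P r) x y
  within-stays s ε = ε
  within-stays s (h ◅ t) = let s′ = s ◅◅ h ◅ ε in (proj₁ h , s , s′) ◅ within-stays s′ t

  -- The new region is the component of the robber in R minus the fixed points of h.
  shrink : ∀ {m} {c : Fin m → V} {R r} (h : V → V) → r ∈ˢ R → h r ≢ r → (∃ λ v → v ∈ˢ R × h v ≡ v) →
    (∀ {R′} → R′ ⊂ R → r ∈ˢ R′ → ConnectedOn G (_∈ˢ R′) →
      (∀ {v} → v ∈ˢ R′ → h v ≢ v) →
      (∀ {v} → Border R′ v → (v ∈ˢ R × h v ≡ v) ⊎ Border R v) → Win c r) → Win c r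
  shrink {c = c} {R} {r} h r∈ r-free (v , v∈ , fix) k =
    -- The component `C` comes without a decision procedure. Since winning is decidable, hence
    -- stable, one may be assumed under double negation.
    decidable-stable (win? c r) λ ¬w → ¬¬-decidable C λ C? →
      let
        R′ = comprehension C?
        R′⊆ : R′ ⊆ˢ R
        R′⊆ x∈ = proj₁ (C⊆ (∈-comprehension⁻ C? x∈))
        border : ∀ {v} → Border R′ v → (v ∈ˢ R × h v ≡ v) ⊎ Border R v
        border {v} (v∉ , u , u∈ , e) = side C? v v∉ u∈ e (v ∈? R)
      in ¬w (k (R′⊆ , v , v∈ , λ v∈′ → proj₂ (C⊆ (∈-comprehension⁻ C? v∈′)) fix)
               (∈-comprehension⁺ C? ε)
               (λ x∈ y∈ → conn C? (∈-comprehension⁻ C? x∈) (∈-comprehension⁻ C? y∈))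
               (λ x∈ → proj₂ (C⊆ (∈-comprehension⁻ C? x∈)))
               border)
    where
    Free : V → Set
    Free v = v ∈ˢ R × h v ≢ v
    C : V → Set
    C = Within G Free r
    C⊆ : ∀ {v} → C v → Free v
    C⊆ s = last s (r∈ , r-free)
      where
      last : ∀ {x y} → Within G Free x y → Free x → Free y
      last ε q = q
      last ((_ , _ , q) ◅ s) _ = last s q
    conn : (C? : ∀ x → Dec (C x)) → ∀ {x y} → C x → C y → Within G (_∈ˢ comprehension C?) x y
    conn C? s t = Star.map (λ (e , p , q) → e , ∈-comprehension⁺ C? p , ∈-comprehension⁺ C? q)
      (within-stays s (within-sym s ◅◅ t))
    side : (C? : ∀ x → Dec (C x)) → ∀ v → v ∉ˢ comprehension C? → ∀ {u} → u ∈ˢ comprehension C? → u ~ v →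
      Dec (v ∈ˢ R) → (v ∈ˢ R × h v ≡ v) ⊎ Border R v
    side C? v v∉ {u} u∈ e (no v∉R) = inj₂ (v∉R , u , proj₁ (C⊆ (∈-comprehension⁻ C? u∈)) , e)
    -- A vertex of `R` adjacent to the component but outside it must be fixed by `h`; otherwise the
    -- walk inside the component would extend to it.
    side C? v v∉ {u} u∈ e (yes v∈R) = inj₁ (v∈R , decidable-stable (h v ≟ v) λ ¬fix →
      v∉ (∈-comprehension⁺ C? (∈-comprehension⁻ C? u∈ ◅◅ (e , C⊆ (∈-comprehension⁻ C? u∈) , v∈R , ¬fix) ◅ ε)))

  -- Two takeovers with a shrinking in between. While cop `zero` takes up the new guard, the old
  -- cops hold the whole border. Afterwards `zero` protects the new border vertices and, by
  -- `cover′`, all that only cop `suc i` protected, so `suc i` may leave its post and join the same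
  -- guard. From then on `zero` is a duplicate.
  replaceGuard : ∀ {k R} (g : Fin (suc k) → V → V) → (∀ j → Guards R (g j)) → (i : Fin k) (T : Track R) →
    (let guard = Track.guard T) →
    (∃ λ v → v ∈ˢ R × guard v ≡ v) →
    (∀ {v} → Border R v → ∃ λ j → g (suc j) v ≡ v) →
    (∀ {v} → Border R v → (∃ λ j → j ≢ i × g (suc j) v ≡ v) ⊎ guard v ≡ v) →
    (let g′ = updateAt (updateAt g zero (const guard)) (suc i) (const guard)) →
    (∀ {R′} → R′ ⊂ R → ConnectedOn G (_∈ˢ R′) → (∀ j → Guards R′ (g′ j)) →
      (∀ {v} → v ∈ˢ R′ → guard v ≢ v) →
      (∀ {v} → Border R′ v → (v ∈ˢ R × guard v ≡ v) ⊎ Border R v) →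
      ∀ {r} → r ∈ˢ R′ → Win (λ j → g′ j r) r) →
    ∀ {r} → r ∈ˢ R → Win (λ j → g j r) r
  replaceGuard {R = R} g guards i T hit cover cover′ next =
    acquire g guards zero (λ bd → let (j , fix) = cover bd in suc j , (λ ()) , fix) T λ {r} r∈ → split r∈ (guard r ≟ r)
    where
    open Track T using (guard) renaming (guards to T-guards)
    g₁ : Fin _ → V → V
    g₁ = updateAt g zero (const guard)
    guards-update : ∀ {R m} {g : Fin m → V → V} i {h} → (∀ j → Guards R (g j)) → Guards R h →
      ∀ j → Guards R (updateAt g i (const h) j)
    guards-update {R} {g = g} i gs hs j with j ≟ i
    ... | yes refl = subst (Guards R) (sym (updateAt-updates i g)) hs
    ... | no j≢i   = subst (Guards R) (sym (updateAt-minimal j i g j≢i)) (gs j)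
    split : ∀ {r} → r ∈ˢ R → Dec (guard r ≡ r) → Win (λ j → g₁ j r) r
    split r∈ (yes fix) = caught zero fix
    split {r} r∈ (no ¬fix) = shrink guard r∈ ¬fix hit λ {R′} R′⊂R r∈′ conn free border →
      let R′⊆R = proj₁ R′⊂R
          g₁-guards = guards-update {R′} zero (λ j → Guards-⊆ {g = g j} R′⊆R (guards j)) (Guards-⊆ {g = guard} R′⊆R T-guards)
      in acquire g₁ g₁-guards (suc i)
        (λ bd → [ (λ (_ , fix) → zero , (λ ()) , fix)
               , (λ bd → [ (λ (j , j≢i , fix) → suc j , (λ { refl → j≢i refl }) , fix)
                        , (λ fix → zero , (λ ()) , fix) ]′ (cover′ bd)) ]′ (border bd))
        (record
          { p = Track.p T ; f = Track.f T ; p-step = Track.p-step T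
          ; f-lip = λ p q → Track.f-lip T (R′⊆R p) (R′⊆R q)
          -- A vertex outside `R′` may still lie in `R`, where `Track.exit T` says nothing; the
          -- guard condition on `R` handles both cases.
          ; exit = λ {x} {x′} p q e fix → subst (Move (guard x)) fix (T-guards (R′⊆R p) e (inj₂ fix))
          })
        (next R′⊂R conn (guards-update (suc i) g₁-guards (Guards-⊆ {g = guard} R′⊆R T-guards)) free border)
        r∈′

-- Shortest paths through the region and their guards

module Geodesics {n : ℕ} (G : Graph (Fin n)) (G-connected : Connected G) where
  open Graph G
  open Game G using (Move)
  open Guarding G G-connected

  private
    V = Fin n

  -- Walk s xs e: the vertices xs are the internal vertices of a walk from s to e.
  data Walk : V → List V → V → Set where
    []  : ∀ {s e} → s ~ e → Walk s [] e
    _∷_ : ∀ {s x xs e} → s ~ x → Walk x xs e → Walk s (x ∷ xs) e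

  -- The converse `on-path` of `fix` matters as much as `fix`: a vertex of `R` that shrinking puts
  -- on the border is known only to be a fixed point of the guard, and must be located on the path
  -- to receive a label.
  record Geodesic (R : Subset n) (u w : V) : Set where
    field
      path    : List V
      walk    : Walk u path w
      within  : ∀ {v} → v ∈ path → v ∈ˢ R
      unique  : Unique path
      hit     : ∃ λ v → v ∈ path
      track   : Track R

    guard : V → V
    guard = Track.guard track

    field
      fix-u   : guard u ≡ u
      fix-w   : guard w ≡ w
      fix     : ∀ {v} → v ∈ path → guard v ≡ v
      on-path : ∀ {v} → v ∈ˢ R → guard v ≡ v → v ∈ path

  module _ {R : Subset n} (R-connected : ConnectedOn G (_∈ˢ R)) {u w : V}
           (bu : Border R u) (bw : Border R w) where

    private
      -- Ends of walks of a given length that start at a neighbour of `u` and stay in `R`. The least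
      -- layer of a vertex is thus its distance from `u` through `R`, minus one.
      Layer : ℕ → V → Set
      Layer zero    v = v ∈ˢ R × u ~ v
      Layer (suc k) v = v ∈ˢ R × ∃ λ x → Layer k x × x ~ v

      layer? : ∀ k v → Dec (Layer k v)
      layer? zero    v = (v ∈? R) ×-dec (u ~? v)
      layer? (suc k) v = (v ∈? R) ×-dec any? λ x → layer? k x ×-dec (x ~? v)

      Layer⊆R : ∀ k {v} → Layer k v → v ∈ˢ R
      Layer⊆R zero    = proj₁
      Layer⊆R (suc k) = proj₁

      layered : ∀ {v} → v ∈ˢ R → ∃ λ k → Layer k v
      layered v∈ = let (_ , x , x∈ , e) = bu in extend 0 (x∈ , ~-sym e) (R-connected x∈ v∈)
        where
        extend : ∀ k {x v} → Layer k x → Within G (_∈ˢ R) x v → ∃ λ k → Layer k v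
        extend k l ε = k , l
        extend k l ((e , _ , y∈) ◅ s) = extend (suc k) (y∈ , _ , l , e) s

      leastLayer : ∀ {v} → v ∈ˢ R → ∃ λ k → Layer k v × (∀ {j} → Layer j v → k ≤ j)
      leastLayer {v} v∈ = let (k , l , _ , min) = least (λ k → layer? k v) (proj₂ (layered v∈)) in k , l , min

      d : V → ℕ
      d v with v ∈? R
      ... | yes v∈ = proj₁ (leastLayer v∈)
      ... | no _   = 0

      d-layer : ∀ {v} → v ∈ˢ R → Layer (d v) v
      d-layer {v} v∈ with v ∈? R
      ... | yes v∈ = proj₁ (proj₂ (leastLayer v∈))
      ... | no v∉  = contradiction v∈ v∉

      d-min : ∀ {v k} → Layer k v → d v ≤ k
      d-min {v} {k} l with v ∈? R
      ... | yes v∈ = proj₂ (proj₂ (leastLayer v∈)) l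
      ... | no v∉  = contradiction (Layer⊆R k l) v∉

      d-lip : ∀ {x v} → x ∈ˢ R → v ∈ˢ R → x ~ v → d v ≤ suc (d x)
      d-lip x∈ v∈ e = d-min (v∈ , _ , d-layer x∈ , e)

      predecessor : ∀ {v k} → v ∈ˢ R → d v ≡ suc k → ∃ λ x → x ∈ˢ R × d x ≡ k × x ~ v
      predecessor {v} {k} v∈ eq with subst (λ k → Layer k v) eq (d-layer v∈)
      ... | _ , x , l , e = x , x∈ ,
        ≤-antisym (d-min l) (≤-pred (subst (_≤ suc (d x)) eq (d-lip x∈ v∈ e))) , e
        where
        x∈ : x ∈ˢ R
        x∈ = Layer⊆R k l

      -- Minimality of this level means that a robber in `R` can step to `w` only from levels at
      -- least `K`.
      nearest : ∃ λ k → (∃ λ x → (x ∈ˢ R × d x ≡ k) × x ~ w) × (∀ {x} → x ∈ˢ R → x ~ w → k ≤ d x)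
      nearest =
        let (_ , x , x∈ , e) = bw
            (k , near , _ , min) = least (λ k → any? λ x → ((x ∈? R) ×-dec (d x ℕₚ.≟ k)) ×-dec (x ~? w))
                                         {d x} (x , (x∈ , refl) , e)
        in k , near , λ x∈ e → min (_ , (x∈ , refl) , e)

      K : ℕ
      K = proj₁ nearest

      -- Final segments x ∷ xs of a shortest path from u to w, the first vertex of xs being at distance suc i from u.
      data Ascent (x : V) (i : ℕ) : List V → Set where
        []  : x ~ w → i ≡ suc K → Ascent x i []
        _∷_ : ∀ {v vs} → x ~ v × v ∈ˢ R × d v ≡ i → Ascent v (suc i) vs → Ascent x i (v ∷ vs)

      -- The path is built from its far end: a `predecessor` one level lower is prepended until
      -- level 0, whose vertices are adjacent to `u`.
      ascent : ∀ i {v vs} → v ∈ˢ R → d v ≡ i → Ascent v (suc i) vs → ∃ (Ascent u 0)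
      ascent zero v∈ eq A =
        _ , (proj₂ (subst (λ k → Layer k _) eq (d-layer v∈)) , v∈ , eq) ∷ A
      ascent (suc i) v∈ eq A = let (x , x∈ , eq′ , e) = predecessor v∈ eq in
        ascent i x∈ eq′ ((e , v∈ , eq) ∷ A)

      Ascent⇒Walk : ∀ {x i xs} → Ascent x i xs → Walk x xs w
      Ascent⇒Walk ([] e _)      = [] e
      Ascent⇒Walk ((e , _) ∷ A) = e ∷ Ascent⇒Walk A

      Ascent⇒∈R : ∀ {x i xs v} → Ascent x i xs → v ∈ xs → v ∈ˢ R
      Ascent⇒∈R ((_ , v∈ , _) ∷ _) (here refl) = v∈
      Ascent⇒∈R (_ ∷ A)            (there v∈)  = Ascent⇒∈R A v∈

      Ascent⇒level≥ : ∀ {x i xs v} → Ascent x i xs → v ∈ xs → i ≤ d v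
      Ascent⇒level≥ ((_ , _ , eq) ∷ _) (here refl) = ≤-reflexive (sym eq)
      Ascent⇒level≥ (_ ∷ A)            (there v∈)  = ≤-trans (n≤1+n _) (Ascent⇒level≥ A v∈)

      Ascent⇒Unique : ∀ {x i xs} → Ascent x i xs → Unique xs
      Ascent⇒Unique ([] _ _) = []
      Ascent⇒Unique ((_ , _ , refl) ∷ A) =
        All.tabulate (λ v∈ → λ { refl → <-irrefl refl (Ascent⇒level≥ A v∈) }) ∷ Ascent⇒Unique A

      Ascent⇒≤ : ∀ {x i xs} → Ascent x i xs → i ≤ suc K
      Ascent⇒≤ ([] _ eq) = ≤-reflexive eq
      Ascent⇒≤ (_ ∷ A)   = ≤-trans (n≤1+n _) (Ascent⇒≤ A)

      at : List V → ℕ → V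
      at []       _       = w
      at (v ∷ vs) zero    = v
      at (v ∷ vs) (suc j) = at vs j

      at-step : ∀ {x i xs} → Ascent x i xs → ∀ j → Move (at (x ∷ xs) j) (at (x ∷ xs) (suc j))
      at-step ([] e _)      zero    = [ e ]
      at-step ([] e _)      (suc j) = refl
      at-step ((e , _) ∷ A) zero    = [ e ]
      at-step (_ ∷ A)       (suc j) = at-step A j

      at-∈ : ∀ {x i xs v} → Ascent x i xs → v ∈ xs → ∃ λ j → d v ≡ i + j × at xs j ≡ v
      at-∈ {i = i} ((_ , _ , eq) ∷ _) (here refl) = 0 , trans eq (sym (+-identityʳ i)) , refl
      at-∈ {i = i} (_ ∷ A) (there v∈) =
        let (j , eq , p) = at-∈ A v∈ in suc j , trans eq (sym (+-suc i j)) , p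

      at-range : ∀ xs j → at xs j ∈ xs ⊎ at xs j ≡ w
      at-range []       _       = inj₂ refl
      at-range (x ∷ xs) zero    = inj₁ (here refl)
      at-range (x ∷ xs) (suc j) = [ (λ v∈ → inj₁ (there v∈)) , inj₂ ]′ (at-range xs j)

      at-end : ∀ {x i xs} → Ascent x i xs → ∀ j → suc K ≤ i + j → at xs j ≡ w
      at-end ([] _ _) j _ = refl
      at-end {i = i} (_∷_ {v} {vs} _ A) zero K< =
        contradiction (≤-trans (s≤s (≤-trans K< (≤-reflexive (+-identityʳ i)))) (Ascent⇒≤ A)) (<-irrefl refl)
      at-end {i = i} (_ ∷ A) (suc j) K< = at-end A j (≤-trans K< (≤-reflexive (+-suc i j)))

      at-last : ∀ {x i xs} → Ascent x i xs → ∀ j → K ≤ i + j → Move (at xs j) w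
      at-last ([] _ _) j _ = refl
      at-last {i = i} ((_ , _ , _) ∷ ([] e _)) zero K≤ = [ e ]
      at-last {i = i} (_∷_ {v} {v′ ∷ vs} _ (_ ∷ A)) zero K≤ =
        contradiction (≤-trans (s≤s (s≤s (≤-trans K≤ (≤-reflexive (+-identityʳ i))))) (Ascent⇒≤ A)) (<-irrefl refl)
      at-last {i = i} (_ ∷ A) (suc j) K≤ = at-last A j (≤-trans K≤ (≤-reflexive (+-suc i j)))

      shortest : ∃ (Ascent u 0)
      shortest = let (_ , (x , (x∈ , eq) , e) , _) = nearest in ascent K x∈ eq ([] e refl)

    -- The guard answers a robber at some level with the path vertex of the same level, or with `w`
    -- beyond level `K`. A step inside `R` changes the level by at most one. The robber enters `u`
    -- only from level 0 and `w` only from levels at least `K`, and there the guard is within one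
    -- step of that end.
    geodesic : Geodesic R u w
    geodesic = record
      { path    = xs
      ; walk    = Ascent⇒Walk A
      ; within  = Ascent⇒∈R A
      ; unique  = Ascent⇒Unique A
      ; hit     = nonempty A
      ; track   = record { p = p ; f = f ; p-step = at-step A ; f-lip = f-lip ; exit = exit }
      ; fix-u   = cong p f-u
      ; fix-w   = fix-w
      ; fix     = fix
      ; on-path = on-path
      }
      where
      xs : List V
      xs = proj₁ shortest
      A : Ascent u 0 xs
      A = proj₂ shortest
      nonempty : ∀ {xs} → Ascent u 0 xs → ∃ λ v → v ∈ xs
      nonempty (_ ∷ _) = _ , here refl
      p : ℕ → V
      p = at (u ∷ xs)
      -- Indices along `u ∷ xs`: 0 is `u`, level `k` sits at `suc k`, and `suc (suc K)` is the first
      -- index past the path, where `at` returns `w`.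
      level : ∀ {v} → Dec (v ≡ u) → Dec (v ∈ˢ R) → ℕ
      level     (yes _) _       = 0
      level {v} (no _)  (yes _) = suc (d v)
      level     (no _)  (no _)  = suc (suc K)
      f : V → ℕ
      f v = level (v ≟ u) (v ∈? R)
      f-u : f u ≡ 0
      f-u with u ≟ u
      ... | yes _  = refl
      ... | no u≢u = contradiction refl u≢u
      f-R : ∀ {v} → v ∈ˢ R → f v ≡ suc (d v)
      f-R {v} v∈ = go (v ≟ u) (v ∈? R)
        where
        go : ∀ x y → level {v} x y ≡ suc (d v)
        go (yes refl) _       = contradiction v∈ (proj₁ bu)
        go (no _)     (yes _) = refl
        go (no _)     (no v∉) = contradiction v∈ v∉
      f-lip : ∀ {r r′} → r ∈ˢ R → r′ ∈ˢ R → r ~ r′ → f r ≤ suc (f r′)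
      f-lip r∈ r′∈ e rewrite f-R r∈ | f-R r′∈ = s≤s (d-lip r′∈ r∈ (~-sym e))
      exit : ∀ {r r′} → r ∈ˢ R → r′ ∉ˢ R → r ~ r′ → p (f r′) ≡ r′ → Move (p (f r)) r′
      exit {r} {r′} r∈ r′∉ e fixed rewrite f-R r∈ = goal (f r′) fixed
        where
        to-u : u ~ r → Move (at xs (d r)) u
        to-u e with d r | d-min {k = 0} (r∈ , e)
        ... | .0 | z≤n = move-sym (at-step A 0)
        goal : ∀ k → p k ≡ r′ → Move (at xs (d r)) r′
        goal zero refl = to-u (~-sym e)
        goal (suc k) eq with at-range xs k
        ... | inj₁ v∈ = contradiction (subst (_∈ˢ R) eq (Ascent⇒∈R A v∈)) r′∉
        ... | inj₂ v≡w with trans (sym v≡w) eq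
        ...   | refl = at-last A (d r) (proj₂ (proj₂ nearest) r∈ e)
      fix-w : p (f w) ≡ w
      fix-w = go (w ≟ u) (w ∈? R)
        where
        go : ∀ x y → p (level x y) ≡ w
        go (yes refl) _       = refl
        go (no _)     (yes w∈) = contradiction w∈ (proj₁ bw)
        go (no _)     (no _)  = at-end A (suc K) ≤-refl
      fix : ∀ {v} → v ∈ xs → p (f v) ≡ v
      fix v∈ rewrite f-R (Ascent⇒∈R A v∈) =
        let (j , eq , q) = at-∈ A v∈ in trans (cong (at xs) eq) q
      on-path : ∀ {v} → v ∈ˢ R → p (f v) ≡ v → v ∈ xs
      on-path {v} v∈ eq rewrite f-R v∈ with at-range xs (d v)
      ... | inj₁ q = subst (_∈ xs) eq q
      ... | inj₂ q = contradiction (subst (_∈ˢ R) (trans (sym eq) q) v∈) (proj₁ bw)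

-- Cutting lists at marked entries

unique-++⁻ : ∀ {A : Set} (xs {ys} : List A) → Unique (xs ++ ys) → Unique xs × Unique ys × Disjoint xs ys
unique-++⁻ [] u = [] , u , λ { (() , _) }
unique-++⁻ (x ∷ xs) (x∉ ∷ u) with unique-++⁻ xs u
... | uxs , uys , dis =
  All.tabulate (λ v∈ → All.lookup x∉ (∈-++⁺ˡ v∈)) ∷ uxs , uys ,
  λ { (here refl , v∈′) → All.lookup x∉ (∈-++⁺ʳ xs v∈′) refl ; (there v∈ , v∈′) → dis (v∈ , v∈′) }

module _ {A : Set} {T : A → Set} (T? : ∀ x → Dec (T x)) where

  first : ∀ xs → (∀ {v} → v ∈ xs → ¬ T v) ⊎
    ∃₂ λ pre x → ∃ λ post → xs ≡ pre ++ x ∷ post × T x × (∀ {v} → v ∈ pre → ¬ T v)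
  first [] = inj₁ λ ()
  first (x ∷ xs) with T? x | first xs
  ... | yes tx | _ = inj₂ ([] , x , xs , refl , tx , λ ())
  ... | no ¬tx | inj₁ none = inj₁ λ { (here refl) → ¬tx ; (there v∈) → none v∈ }
  ... | no ¬tx | inj₂ (pre , y , post , eq , ty , none) =
    inj₂ (x ∷ pre , y , post , cong (x ∷_) eq , ty , λ { (here refl) → ¬tx ; (there v∈) → none v∈ })

  last : ∀ xs → (∀ {v} → v ∈ xs → ¬ T v) ⊎
    ∃₂ λ pre x → ∃ λ post → xs ≡ pre ++ x ∷ post × T x × (∀ {v} → v ∈ post → ¬ T v)
  last [] = inj₁ λ ()
  last (x ∷ xs) with last xs | T? x
  ... | inj₂ (pre , y , post , eq , ty , none) | _ = inj₂ (x ∷ pre , y , post , cong (x ∷_) eq , ty , none)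
  ... | inj₁ none | yes tx = inj₂ ([] , x , xs , refl , tx , none)
  ... | inj₁ none | no ¬tx = inj₁ λ { (here refl) → ¬tx ; (there v∈) → none v∈ }

  data Few (xs : List A) : Set where
    none : (∀ {v} → v ∈ xs → ¬ T v) → Few xs
    one  : ∀ pre x post → xs ≡ pre ++ x ∷ post → T x →
           (∀ {v} → v ∈ xs → T v → v ≡ x) → Few xs
    two  : ∀ pre x mid y post → xs ≡ pre ++ x ∷ mid ++ y ∷ post → T x → T y →
           (∀ {v} → v ∈ xs → T v → v ≡ x ⊎ v ≡ y) → Few xs

  record Many (xs : List A) : Set where
    field
      {xs₁ xs₂ xs₃} : List A
      split : xs ≡ xs₁ ++ xs₂ ++ xs₃
      hit₁  : ∃ λ v → v ∈ xs₁ × T v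
      hit₂  : ∃ λ v → v ∈ xs₂ × T v
      hit₃  : ∃ λ v → v ∈ xs₃ × T v

  -- The cuts fall right after the first and the second marked entry; the third segment is all the
  -- rest.
  few-or-many : ∀ xs → Few xs ⊎ Many xs
  few-or-many xs with first xs
  ... | inj₁ none′ = inj₁ (none none′)
  ... | inj₂ (pre , x , post , refl , tx , none₁) with first post
  ...   | inj₁ none₂ = inj₁ (one pre x post refl tx λ v∈ tv → only (∈-++⁻ pre v∈) tv)
    where
    only : ∀ {v} → v ∈ pre ⊎ v ∈ x ∷ post → T v → v ≡ x
    only (inj₁ v∈)          tv = contradiction tv (none₁ v∈)
    only (inj₂ (here eq))   tv = eq
    only (inj₂ (there v∈))  tv = contradiction tv (none₂ v∈)
  ...   | inj₂ (mid , y , post′ , refl , ty , none₂) with first post′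
  ...     | inj₁ none₃ = inj₁ (two pre x mid y post′ refl tx ty λ v∈ tv → only (∈-++⁻ pre v∈) tv)
    where
    only′ : ∀ {v} → v ∈ mid ⊎ v ∈ y ∷ post′ → T v → v ≡ y
    only′ (inj₁ v∈)          tv = contradiction tv (none₂ v∈)
    only′ (inj₂ (here eq))   tv = eq
    only′ (inj₂ (there v∈))  tv = contradiction tv (none₃ v∈)
    only : ∀ {v} → v ∈ pre ⊎ v ∈ x ∷ mid ++ y ∷ post′ → T v → v ≡ x ⊎ v ≡ y
    only (inj₁ v∈)          tv = contradiction tv (none₁ v∈)
    only (inj₂ (here eq))   tv = inj₁ eq
    only (inj₂ (there v∈))  tv = inj₂ (only′ (∈-++⁻ mid v∈) tv)
  ...     | inj₂ (mid′ , z , post″ , refl , tz , _) = inj₂ record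
    { xs₁ = pre ++ x ∷ [] ; xs₂ = mid ++ y ∷ [] ; xs₃ = mid′ ++ z ∷ post″
    ; split = sym (trans (++-assoc pre (x ∷ []) _) (cong (λ l → pre ++ x ∷ l) (++-assoc mid (y ∷ []) _)))
    ; hit₁ = x , ∈-++⁺ʳ pre (here refl) , tx
    ; hit₂ = y , ∈-++⁺ʳ mid (here refl) , ty
    ; hit₃ = z , ∈-++⁺ʳ mid′ (here refl) , tz
    }

-- Walks as lists of internal vertices

module Walks {n : ℕ} (G : Graph (Fin n)) (G-connected : Connected G) where
  open Graph G
  open Guarding G G-connected
  open Geodesics G G-connected

  private
    V = Fin n

  walk-++ : ∀ {s y e} xs {ys} → Walk s xs y → Walk y ys e → Walk s (xs ++ y ∷ ys) e
  walk-++ []       ([] e)  W′ = e ∷ W′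
  walk-++ (x ∷ xs) (e ∷ W) W′ = e ∷ walk-++ xs W W′

  walk-split : ∀ {s y e} xs {ys} → Walk s (xs ++ y ∷ ys) e → Walk s xs y × Walk y ys e
  walk-split []       (e ∷ W) = [] e , W
  walk-split (x ∷ xs) (e ∷ W) = let (W₁ , W₂) = walk-split xs W in e ∷ W₁ , W₂

  walk-drop : ∀ {s e} xs {ys} → Walk s (xs ++ ys) e → ∃ λ y → Walk y ys e
  walk-drop []       W       = _ , W
  walk-drop (x ∷ xs) (_ ∷ W) = walk-drop xs W

  walk-forward : ∀ {P : V → Set} {s e} xs {ys} → Walk s (xs ++ ys) e → P s → (∀ {v} → v ∈ xs → P v) →
    ∀ {v} → v ∈ xs → Within G P s v
  walk-forward (x ∷ xs) (e ∷ W) ps pxs (here refl) = (e , ps , pxs (here refl)) ◅ ε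
  walk-forward (x ∷ xs) (e ∷ W) ps pxs (there v∈)  =
    (e , ps , pxs (here refl)) ◅ walk-forward xs W (pxs (here refl)) (pxs ∘ there) v∈

  walk-backward : ∀ {P : V → Set} {s e xs} → Walk s xs e → P e → (∀ {v} → v ∈ xs → P v) →
    ∀ {v} → v ∈ xs → Within G P v e
  walk-backward (_ ∷ [] e)        pe pxs (here refl) = (e , pxs (here refl) , pe) ◅ ε
  walk-backward (_ ∷ W@(e ∷ _))   pe pxs (here refl) =
    (e , pxs (here refl) , pxs (there (here refl))) ◅ walk-backward W pe (pxs ∘ there) (here refl)
  walk-backward (_ ∷ W)           pe pxs (there v∈)  = walk-backward W pe (pxs ∘ there) v∈

  walk-connected : ∀ {s e} xs {ys} → Walk s (xs ++ ys) e → ConnectedOn G (_∈ xs)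
  walk-connected (x ∷ xs) (_ ∷ W) u∈ v∈ = within-sym (from-x u∈) ◅◅ from-x v∈
    where
    from-x : ∀ {v} → v ∈ x ∷ xs → Within G (_∈ x ∷ xs) x v
    from-x (here refl) = ε
    from-x (there v∈)  = walk-forward xs W (here refl) there v∈

  walk-first : ∀ {s e u xs ys} → Walk s (xs ++ ys) e → u ∈ xs → ∃ λ x → x ∈ xs × s ~ x
  walk-first {xs = _ ∷ _} (e ∷ _) _ = _ , here refl , e

  walk-last : ∀ {s e u xs} → Walk s xs e → u ∈ xs → ∃ λ x → x ∈ xs × x ~ e
  walk-last (_ ∷ [] e)      _ = _ , here refl , e
  walk-last (_ ∷ W@(_ ∷ _)) _ = let (x , x∈ , e) = walk-last W (here refl) in x , there x∈ , e

  walk-join : ∀ {s e u v} xs {ys zs} → Walk s (xs ++ ys ++ zs) e → u ∈ xs → v ∈ ys →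
    ∃₂ λ x y → x ∈ xs × y ∈ ys × x ~ y
  walk-join (x ∷ []) (_ ∷ W) _ v∈ = let (y , y∈ , e) = walk-first W v∈ in x , y , here refl , y∈ , e
  walk-join (x ∷ xs@(_ ∷ _)) (_ ∷ W) _ v∈ =
    let (x′ , y , x∈ , y∈ , e) = walk-join xs W (here refl) v∈ in x′ , y , there x∈ , y∈ , e

-- Cores and slots

data Label (k : ℕ) : Set where
  out  : Label k
  core : Bool → Label k
  slot : Fin k → Label k

slot-injective : ∀ {k} {i j : Fin k} → slot i ≡ slot j → i ≡ j
slot-injective refl = refl

core≢slot : ∀ {k s} {i : Fin k} → core s ≢ slot i
core≢slot ()

_≟ᴸ_ : ∀ {k} → DecidableEquality (Label k)
out    ≟ᴸ out     = yes refl
out    ≟ᴸ core _  = no λ ()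
out    ≟ᴸ slot _  = no λ ()
core _ ≟ᴸ out     = no λ ()
core s ≟ᴸ core s′ = map′ (cong core) (λ { refl → refl }) (s Boolₚ.≟ s′)
core _ ≟ᴸ slot _  = no λ ()
slot _ ≟ᴸ out     = no λ ()
slot _ ≟ᴸ core _  = no λ ()
slot i ≟ᴸ slot j  = map′ (cong slot) slot-injective (i ≟ j)

-- The cop responsible for a label: the cores are guarded together with slot zero.
warden : ∀ {t} → Label (suc t) → Fin (suc t)
warden (slot i) = i
warden _        = zero

module States {n : ℕ} (G : Graph (Fin n)) (G-connected : Connected G) (t : ℕ) where
  open Graph G
  open Pursuit G
  open Guarding G G-connected
  open Geodesics G G-connected
  open Walks G G-connected

  private
    V = Fin n
    _∈ᴸ?_ = member? (_≟_ {n})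

  module _ (ws : List V) (ℓ : Label (suc t)) (lab : V → Label (suc t)) where
    relabel : V → Label (suc t)
    relabel v with v ∈ᴸ? ws
    ... | yes _ = ℓ
    ... | no _  = lab v

    relabel-∈ : ∀ {v} → v ∈ ws → relabel v ≡ ℓ
    relabel-∈ {v} v∈ with v ∈ᴸ? ws
    ... | yes _ = refl
    ... | no v∉ = contradiction v∈ v∉

    relabel-∉ : ∀ {v} → ¬ (v ∈ ws) → relabel v ≡ lab v
    relabel-∉ {v} v∉ with v ∈ᴸ? ws
    ... | yes v∈ = contradiction v∈ v∉
    ... | no _   = refl

    relabel⁻ : ∀ {v ℓ′} → ℓ ≢ ℓ′ → relabel v ≡ ℓ′ → ¬ (v ∈ ws) × lab v ≡ ℓ′
    relabel⁻ {v} ℓ≢ eq with v ∈ᴸ? ws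
    ... | yes _ = contradiction eq ℓ≢
    ... | no v∉ = v∉ , eq

  -- The cores true and false become the branch sets of the two ends of H t, and the path Q i
  -- between them, when not abandoned (empty), supplies the internal vertices of one path of H t.
  record State (R : Subset n) : Set where
    field
      lab      : V → Label (suc t)
      R-out    : ∀ {v} → v ∈ˢ R → lab v ≡ out
      conn     : ∀ s → ConnectedOn G (λ v → lab v ≡ core s)
      Q        : Fin (suc t) → List V
      Q-lab    : ∀ i {v} → v ∈ Q i → lab v ≡ slot i
      Q-unique : ∀ i → Unique (Q i)
      Q-walk   : ∀ i → Q i ≡ [] ⊎ ∃₂ λ s e → lab s ≡ core true × lab e ≡ core false × Walk s (Q i) e
      on-Q     : ∀ {i v} → Border R v → lab v ≡ slot i → v ∈ Q i
      single   : ∀ s {u v} → Border R u → Border R v → lab u ≡ core s → lab v ≡ core s → u ≡ v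
      labelled : ∀ {v} → Border R v → lab v ≢ out

  Attached : ∀ {R} → State R → Label (suc t) → Set
  Attached {R} st ℓ = ∃ λ v → Border R v × State.lab st v ≡ ℓ

  attached? : ∀ {R} (st : State R) ℓ → Dec (Attached st ℓ)
  attached? {R} st ℓ = any? λ v → border? R v ×-dec (State.lab st v ≟ᴸ ℓ)

  -- The only change from st to st′ is that slot vertices have been moved into cores.
  record _≼_ {R} (st st′ : State R) : Set where
    private
      module S = State st
      module S′ = State st′
    field
      slot⁻ : ∀ {v i} → S′.lab v ≡ slot i → S.lab v ≡ slot i
      core⁺ : ∀ {v s} → S.lab v ≡ core s → S′.lab v ≡ core s

  ≼-refl : ∀ {R} {st : State R} → st ≼ st
  ≼-refl = record { slot⁻ = λ p → p ; core⁺ = λ p → p }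

  module _ {R : Subset n} (st : State R) (s : Bool) (¬att : ¬ Attached st (core s)) (i : Fin (suc t))
           (ws rest : List V) where
    open State st

    private
      lab′ : V → Label (suc t)
      lab′ = relabel ws (core s) lab

    -- The growing core has no border vertex of its own and `ws` has at most one, so `single` is
    -- preserved. Connectedness goes through the old core, to which `reach` ties each new vertex.
    absorb :
      (∀ {v} → v ∈ ws → v ∈ Q i) → (∀ {v} → v ∈ rest → v ∈ Q i) → Unique rest → Disjoint ws rest →
      (∀ {v} → v ∈ Q i → v ∈ ws ⊎ v ∈ rest) →
      (∃ λ x → ∀ {v} → v ∈ ws → Border R v → v ≡ x) →
      (∀ {v} → v ∈ ws → ∃ λ u → lab u ≡ core s × Within G (λ v → lab′ v ≡ core s) u v) →
      (∃₂ λ c e → lab′ c ≡ core true × lab′ e ≡ core false × Walk c rest e) →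
      ∃ λ (st′ : State R) → State.lab st′ ≡ lab′
    absorb ws⊆ rest⊆ rest-unique disjoint cover (x , only-x) reach rest-walk = record
      { lab      = lab′
      ; R-out    = λ v∈ → trans (lab-≢ λ eq → contradiction (trans (sym (R-out v∈)) eq) λ ()) (R-out v∈)
      ; conn     = conn′
      ; Q        = updateAt Q i (const rest)
      ; Q-lab    = Q-lab′
      ; Q-unique = Q-unique′
      ; Q-walk   = Q-walk′
      ; on-Q     = λ bd eq → on-Q′ bd (relabel⁻ ws (core s) lab (λ ()) eq)
      ; single   = single′
      ; labelled = λ bd eq → labelled bd (proj₂ (relabel⁻ ws (core s) lab (λ ()) eq))
      } , refl
      where
      lab-≢ : ∀ {v} → lab v ≢ slot i → lab′ v ≡ lab v
      lab-≢ ≢i = relabel-∉ ws (core s) lab λ v∈ → ≢i (Q-lab i (ws⊆ v∈))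
      keep-core : ∀ {v s′} → lab v ≡ core s′ → lab′ v ≡ core s′
      keep-core eq = trans (lab-≢ λ eq′ → core≢slot (trans (sym eq) eq′)) eq
      base : ∀ {v} → lab′ v ≡ core s → ∃ λ u → lab u ≡ core s × Within G (λ v → lab′ v ≡ core s) u v
      base {v} eq with v ∈ᴸ? ws
      ... | yes v∈ = reach v∈
      ... | no v∉  = v , eq , ε
      lift : ∀ s′ {x y} → Within G (λ v → lab v ≡ core s′) x y → Within G (λ v → lab′ v ≡ core s′) x y
      lift s′ = Star.map λ (e , p , q) → e , keep-core p , keep-core q
      conn′ : ∀ s′ → ConnectedOn G (λ v → lab′ v ≡ core s′)
      conn′ s′ p q with s Boolₚ.≟ s′
      ... | yes refl = let (u , lu , r) = base p
                           (v , lv , r′) = base q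
                       in within-sym r ◅◅ lift s (conn s lu lv) ◅◅ r′
      ... | no s≢ = lift s′ (conn s′ (back p) (back q))
        where
        back : ∀ {v} → lab′ v ≡ core s′ → lab v ≡ core s′
        back = proj₂ ∘ relabel⁻ ws (core s) lab λ { refl → s≢ refl }
      Q′ : Fin (suc t) → List V
      Q′ = updateAt Q i (const rest)
      Q-lab′ : ∀ j {v} → v ∈ Q′ j → lab′ v ≡ slot j
      Q-lab′ j {v} v∈ with j ≟ i
      ... | yes refl = let v∈′ = subst (v ∈_) (updateAt-updates i Q) v∈ in
        trans (relabel-∉ ws (core s) lab λ v∈ws → disjoint (v∈ws , v∈′)) (Q-lab i (rest⊆ v∈′))
      ... | no j≢i = let eq = Q-lab j (subst (v ∈_) (updateAt-minimal j i Q j≢i) v∈) in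
        trans (lab-≢ λ eq′ → j≢i (slot-injective (trans (sym eq) eq′))) eq
      Q-unique′ : ∀ j → Unique (Q′ j)
      Q-unique′ j with j ≟ i
      ... | yes refl = subst Unique (sym (updateAt-updates i Q)) rest-unique
      ... | no j≢i   = subst Unique (sym (updateAt-minimal j i Q j≢i)) (Q-unique j)
      WalkFor : List V → Set
      WalkFor l = l ≡ [] ⊎ ∃₂ λ s e → lab′ s ≡ core true × lab′ e ≡ core false × Walk s l e
      Q-walk′ : ∀ j → WalkFor (Q′ j)
      Q-walk′ j with j ≟ i
      ... | yes refl = subst WalkFor (sym (updateAt-updates i Q)) (inj₂ rest-walk)
      ... | no j≢i   = subst WalkFor (sym (updateAt-minimal j i Q j≢i))
        ([ inj₁ , (λ (c , e , lc , le , W) → inj₂ (c , e , keep-core lc , keep-core le , W)) ]′ (Q-walk j))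
      on-Q′ : ∀ {j v} → Border R v → ¬ (v ∈ ws) × lab v ≡ slot j → v ∈ Q′ j
      on-Q′ {j} {v} bd (v∉ , eq) with j ≟ i
      ... | yes refl = subst (v ∈_) (sym (updateAt-updates i Q))
        ([ (λ v∈ → contradiction v∈ v∉) , (λ v∈ → v∈) ]′ (cover (on-Q bd eq)))
      ... | no j≢i   = subst (v ∈_) (sym (updateAt-minimal j i Q j≢i)) (on-Q bd eq)
      is-x : ∀ {v} → Border R v → lab′ v ≡ core s → v ≡ x
      is-x {v} bd eq with v ∈ᴸ? ws
      ... | yes v∈ = only-x v∈ bd
      ... | no _   = contradiction (v , bd , eq) ¬att
      single′ : ∀ s′ {u v} → Border R u → Border R v → lab′ u ≡ core s′ → lab′ v ≡ core s′ → u ≡ v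
      single′ s′ bu bv p q with s Boolₚ.≟ s′
      ... | yes refl = trans (is-x bu p) (sym (is-x bv q))
      ... | no s≢    = single s′ bu bv (back p) (back q)
        where
        back : ∀ {v} → lab′ v ≡ core s′ → lab v ≡ core s′
        back = proj₂ ∘ relabel⁻ ws (core s) lab λ { refl → s≢ refl }

  -- The cores share the cop of slot `zero`, so absorbing from that slot leaves every vertex with
  -- its warden. Absorbing from another slot hands a border vertex to a cop that need not protect
  -- it, so `warden≡` is claimed for `zero` alone.
  record Filled {R} (st : State R) (s : Bool) (i : Fin (suc t)) : Set where
    field
      state    : State R
      extends  : st ≼ state
      warden≡  : i ≡ zero → ∀ v → warden (State.lab state v) ≡ warden (State.lab st v)
      attached : Attached state (core s)

  module _ {R : Subset n} (st : State R) where
    open State st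

    private
      finish : ∀ s i ws → (∀ {v} → v ∈ ws → v ∈ Q i) → (∃ λ x → x ∈ ws × Border R x) →
        (∃ λ (st′ : State R) → State.lab st′ ≡ relabel ws (core s) lab) → Filled st s i
      finish s i ws ws⊆ (x , x∈ , bx) (st′ , refl) = record
        { state    = st′
        ; extends  = record
          { slot⁻ = λ eq → proj₂ (relabel⁻ ws (core s) lab (λ ()) eq)
          ; core⁺ = λ eq → trans (relabel-∉ ws (core s) lab λ v∈ →
                      core≢slot (trans (sym eq) (Q-lab i (ws⊆ v∈)))) eq
          }
        ; warden≡  = same
        ; attached = x , bx , relabel-∈ ws (core s) lab x∈
        }
        where
        same : i ≡ zero → ∀ v → warden (relabel ws (core s) lab v) ≡ warden (lab v)
        same refl v with v ∈ᴸ? ws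
        ... | yes v∈ = sym (cong warden (Q-lab i (ws⊆ v∈)))
        ... | no _   = refl

    fill : ∀ s i → ¬ Attached st (core s) → Attached st (slot i) → Filled st s i
    fill true i ¬att (v , bv , lv) with first (border? R) (Q i) | Q-walk i
    ... | inj₁ ¬bd | _ = contradiction bv (¬bd (on-Q bv lv))
    ... | inj₂ (pre , x , post , eq , bx , ¬bd) | inj₁ empty = contradiction (subst (x ∈_) (trans (sym eq) empty) (∈-++⁺ʳ pre (here refl))) λ ()
    ... | inj₂ (pre , x , post , eq , bx , ¬bd) | inj₂ (c , e , lc , le , W) =
      finish true i ws ws⊆ (x , x∈ , bx)
        (absorb st true ¬att i ws post ws⊆ post⊆ (proj₁ (proj₂ parts)) (proj₂ (proj₂ parts)) cover
          (x , λ v∈ bv → only (∈-++⁻ pre v∈) bv)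
          (λ v∈ → c , lc , walk-forward ws W′ (trans lc≡ lc) (relabel-∈ ws (core true) lab) v∈)
          -- Now in the core, `x` is the new starting point of the remaining path.
          (x , e , relabel-∈ ws (core true) lab x∈ , trans le′≡ le , proj₂ (walk-split pre (subst (λ l → Walk c l e) eq W))))
      where
      ws : List V
      ws = pre ++ x ∷ []
      x∈ : x ∈ ws
      x∈ = ∈-++⁺ʳ pre (here refl)
      eq′ : Q i ≡ ws ++ post
      eq′ = trans eq (sym (++-assoc pre (x ∷ []) post))
      W′ : Walk c (ws ++ post) e
      W′ = subst (λ l → Walk c l e) eq′ W
      parts : Unique ws × Unique post × Disjoint ws post
      parts = unique-++⁻ ws (subst Unique eq′ (Q-unique i))
      ws⊆ : ∀ {v} → v ∈ ws → v ∈ Q i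
      ws⊆ {v} v∈ = subst (v ∈_) (sym eq′) (∈-++⁺ˡ v∈)
      post⊆ : ∀ {v} → v ∈ post → v ∈ Q i
      post⊆ {v} v∈ = subst (v ∈_) (sym eq′) (∈-++⁺ʳ ws v∈)
      cover : ∀ {v} → v ∈ Q i → v ∈ ws ⊎ v ∈ post
      cover {v} v∈ = ∈-++⁻ ws (subst (v ∈_) eq′ v∈)
      only : ∀ {v} → v ∈ pre ⊎ v ∈ x ∷ [] → Border R v → v ≡ x
      only (inj₁ v∈) bv = contradiction bv (¬bd v∈)
      only (inj₂ (here eq)) _ = eq
      not-slot : ∀ {s v} → lab v ≡ core s → ¬ (v ∈ ws)
      not-slot l v∈ = core≢slot (trans (sym l) (Q-lab i (ws⊆ v∈)))
      lc≡ : relabel ws (core true) lab c ≡ lab c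
      lc≡ = relabel-∉ ws (core true) lab (not-slot lc)
      le′≡ : relabel ws (core true) lab e ≡ lab e
      le′≡ = relabel-∉ ws (core true) lab (not-slot le)
    fill false i ¬att (v , bv , lv) with last (border? R) (Q i) | Q-walk i
    ... | inj₁ ¬bd | _ = contradiction bv (¬bd (on-Q bv lv))
    ... | inj₂ (pre , x , post , eq , bx , ¬bd) | inj₁ empty = contradiction (subst (x ∈_) (trans (sym eq) empty) (∈-++⁺ʳ pre (here refl))) λ ()
    ... | inj₂ (pre , x , post , eq , bx , ¬bd) | inj₂ (c , e , lc , le , W) =
      finish false i ws ws⊆ (x , here refl , bx)
        (absorb st false ¬att i ws pre ws⊆ pre⊆ (proj₁ parts)
          (λ (p , q) → proj₂ (proj₂ parts) (q , p)) cover
          (x , λ v∈ bv → only v∈ bv)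
          (λ v∈ → e , le , within-sym (walk-backward (proj₂ (walk-drop pre W′)) (trans le′≡ le) (relabel-∈ ws (core false) lab) v∈))
          (c , x , trans lc≡ lc , relabel-∈ ws (core false) lab (here refl) , proj₁ (walk-split pre W′)))
      where
      ws : List V
      ws = x ∷ post
      W′ : Walk c (pre ++ ws) e
      W′ = subst (λ l → Walk c l e) eq W
      parts : Unique pre × Unique ws × Disjoint pre ws
      parts = unique-++⁻ pre (subst Unique eq (Q-unique i))
      pre⊆ : ∀ {v} → v ∈ pre → v ∈ Q i
      pre⊆ {v} v∈ = subst (v ∈_) (sym eq) (∈-++⁺ˡ v∈)
      ws⊆ : ∀ {v} → v ∈ ws → v ∈ Q i
      ws⊆ {v} v∈ = subst (v ∈_) (sym eq) (∈-++⁺ʳ pre v∈)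
      cover : ∀ {v} → v ∈ Q i → v ∈ ws ⊎ v ∈ pre
      cover {v} v∈ = [ inj₂ , inj₁ ]′ (∈-++⁻ pre (subst (v ∈_) eq v∈))
      only : ∀ {v} → v ∈ ws → Border R v → v ≡ x
      only (here eq)  _  = eq
      only (there v∈) bv = contradiction bv (¬bd v∈)
      not-slot : ∀ {s v} → lab v ≡ core s → ¬ (v ∈ ws)
      not-slot l v∈ = core≢slot (trans (sym l) (Q-lab i (ws⊆ v∈)))
      lc≡ : relabel ws (core false) lab c ≡ lab c
      lc≡ = relabel-∉ ws (core false) lab (not-slot lc)
      le′≡ : relabel ws (core false) lab e ≡ lab e
      le′≡ = relabel-∉ ws (core false) lab (not-slot le)

-- Shrinking the region

module Rerouting {n : ℕ} (G : Graph (Fin n)) (G-connected : Connected G) (t : ℕ) where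
  open Graph G
  open Game G using (Move)
  open Pursuit G
  open Guarding G G-connected
  open Geodesics G G-connected
  open Walks G G-connected
  open States G G-connected t

  private
    V = Fin n
    _∈ᴸ?_ = member? (_≟_ {n})

  -- Cop zero is free, cop suc i guards slot i.
  Roles : ∀ {R} → State R → (Fin (suc (suc t)) → V → V) → Set
  Roles {R} st g = ∀ {v} → Border R v → let w = warden (State.lab st v) in g (suc w) v ≡ v

  Winning : Subset n → Set
  Winning R = (g : Fin (suc (suc t)) → V → V) → (∀ j → Guards R (g j)) → ConnectedOn G (_∈ˢ R) →
    (st : State R) → Roles st g → ∀ {r} → r ∈ˢ R → Win (λ j → g j r) r

  updated-roles : ∀ {R′} (g : Fin (suc (suc t)) → V → V) (h : V → V) i (st : State R′) →
    (∀ {v} → Border R′ v → let w = warden (State.lab st v) in (w ≢ i × g (suc w) v ≡ v) ⊎ h v ≡ v × w ≡ i) →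
    Roles st (updateAt (updateAt g zero (const h)) (suc i) (const h))
  updated-roles g h i st cover {v} bd with cover bd
  ... | inj₁ (w≢i , fix) =
    trans (cong (λ k → k v) (updateAt-minimal (suc _) (suc i) (updateAt g zero (const h)) λ { refl → w≢i refl })) fix
  ... | inj₂ (fix , refl) =
    trans (cong (λ k → k v) (updateAt-updates (suc i) (updateAt g zero (const h)))) fix

  module _ {R : Subset n} (st : State R) {u w : V} (γ : Geodesic R u w) (i : Fin (suc t)) (F K : List V) where
    open State st
    private
      module γ = Geodesic γ
      path = γ.path
      lab′ : V → Label (suc t)
      lab′ = relabel path (slot i) lab

    -- The stretch of the old path between `F` and `K` leaves `Q i` but keeps its label `slot i`. By
    -- `ends` it contains no border vertex, so `on-Q` still holds; slot labels off the paths are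
    -- harmless.
    reroutedState :
      (∀ {v} → v ∈ F → v ∈ Q i) → (∀ {v} → v ∈ K → v ∈ Q i) → Unique F → Unique K → Disjoint F K →
      (∀ {v} → Border R v → lab v ≡ slot i → v ∈ F ⊎ v ∈ K) →
      (∃₂ λ s e → lab s ≡ core true × lab e ≡ core false × Walk s (F ++ path ++ K) e) →
      ∀ {R′} → R′ ⊂ R → (∀ {v} → v ∈ˢ R′ → γ.guard v ≢ v) →
      (∀ {v} → Border R′ v → (v ∈ˢ R × γ.guard v ≡ v) ⊎ Border R v) →
      ∃ λ (st′ : State R′) → State.lab st′ ≡ lab′
    reroutedState F⊆ K⊆ F-unique K-unique F#K ends (s₀ , e₀ , ls , le , W) {R′} (R′⊆R , _) free border = record
      { lab      = lab′
      ; R-out    = λ v∈ → trans (relabel-∉ path (slot i) lab λ v∈p → free v∈ (γ.fix v∈p)) (R-out (R′⊆R v∈))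
      ; conn     = λ s p q → Star.map (λ (e , x , y) → e , core⁺ x , core⁺ y) (conn s (core⁻ p) (core⁻ q))
      ; Q        = Q′
      ; Q-lab    = Q-lab′
      ; Q-unique = Q-unique′
      ; Q-walk   = Q-walk′
      ; on-Q     = on-Q′
      ; single   = λ s bu bv p q → single s (old bu (core∉ p)) (old bv (core∉ q)) (core⁻ p) (core⁻ q)
      ; labelled = λ bd eq → let (v∉ , eq′) = relabel⁻ path (slot i) lab (λ ()) eq in labelled (old bd v∉) eq′
      } , refl
      where
      core∉ : ∀ {v s} → lab′ v ≡ core s → ¬ (v ∈ path)
      core∉ eq = proj₁ (relabel⁻ path (slot i) lab (λ ()) eq)
      core⁻ : ∀ {v s} → lab′ v ≡ core s → lab v ≡ core s
      core⁻ eq = proj₂ (relabel⁻ path (slot i) lab (λ ()) eq)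
      labelled∉ : ∀ {v ℓ} → lab v ≡ ℓ → ℓ ≢ out → ¬ (v ∈ path)
      labelled∉ eq ℓ≢ v∈ = ℓ≢ (trans (sym eq) (R-out (γ.within v∈)))
      keep : ∀ {v ℓ} → lab v ≡ ℓ → ℓ ≢ out → lab′ v ≡ ℓ
      keep eq ℓ≢ = trans (relabel-∉ path (slot i) lab (labelled∉ eq ℓ≢)) eq
      core⁺ : ∀ {v s} → lab v ≡ core s → lab′ v ≡ core s
      core⁺ eq = keep eq λ ()
      old : ∀ {v} → Border R′ v → ¬ (v ∈ path) → Border R v
      old bd v∉ = [ (λ (v∈ , fix) → contradiction (γ.on-path v∈ fix) v∉) , (λ bd → bd) ]′ (border bd)
      L : List V
      L = F ++ path ++ K
      Q′ : Fin (suc t) → List V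
      Q′ = updateAt Q i (const L)
      Q-lab′ : ∀ j {v} → v ∈ Q′ j → lab′ v ≡ slot j
      Q-lab′ j {v} v∈ with j ≟ i
      ... | no j≢i = keep (Q-lab j (subst (v ∈_) (updateAt-minimal j i Q j≢i) v∈)) λ ()
      ... | yes refl with ∈-++⁻ F (subst (v ∈_) (updateAt-updates i Q) v∈)
      ...   | inj₁ v∈F = keep (Q-lab i (F⊆ v∈F)) λ ()
      ...   | inj₂ v∈′ with ∈-++⁻ path v∈′
      ...     | inj₁ v∈p = relabel-∈ path (slot i) lab v∈p
      ...     | inj₂ v∈K = keep (Q-lab i (K⊆ v∈K)) λ ()
      path#Q : ∀ {v} → v ∈ path → v ∈ Q i → ⊥
      path#Q v∈ v∈′ = labelled∉ (Q-lab i v∈′) (λ ()) v∈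
      L-unique : Unique L
      L-unique = Unique.++⁺ F-unique
        (Unique.++⁺ γ.unique K-unique λ (v∈p , v∈K) → path#Q v∈p (K⊆ v∈K))
        λ (v∈F , v∈) → [ (λ v∈p → path#Q v∈p (F⊆ v∈F)) , (λ v∈K → F#K (v∈F , v∈K)) ]′ (∈-++⁻ path v∈)
      Q-unique′ : ∀ j → Unique (Q′ j)
      Q-unique′ j with j ≟ i
      ... | yes refl = subst Unique (sym (updateAt-updates i Q)) L-unique
      ... | no j≢i   = subst Unique (sym (updateAt-minimal j i Q j≢i)) (Q-unique j)
      WalkFor : List V → Set
      WalkFor l = l ≡ [] ⊎ ∃₂ λ s e → lab′ s ≡ core true × lab′ e ≡ core false × Walk s l e
      Q-walk′ : ∀ j → WalkFor (Q′ j)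
      Q-walk′ j with j ≟ i
      ... | yes refl = subst WalkFor (sym (updateAt-updates i Q)) (inj₂ (s₀ , e₀ , core⁺ ls , core⁺ le , W))
      ... | no j≢i   = subst WalkFor (sym (updateAt-minimal j i Q j≢i))
        ([ inj₁ , (λ (s , e , ls , le , W) → inj₂ (s , e , core⁺ ls , core⁺ le , W)) ]′ (Q-walk j))
      on-Q′ : ∀ {j v} → Border R′ v → lab′ v ≡ slot j → v ∈ Q′ j
      on-Q′ {j} {v} bd eq with v ∈ᴸ? path
      ... | yes v∈ with slot-injective eq
      ...   | refl = subst (v ∈_) (sym (updateAt-updates i Q)) (∈-++⁺ʳ F (∈-++⁺ˡ v∈))
      on-Q′ {j} {v} bd eq | no v∉ with j ≟ i
      ... | no j≢i   = subst (v ∈_) (sym (updateAt-minimal j i Q j≢i)) (on-Q (old bd v∉) eq)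
      ... | yes refl = subst (v ∈_) (sym (updateAt-updates i Q))
        ([ ∈-++⁺ˡ , (λ v∈K → ∈-++⁺ʳ F (∈-++⁺ʳ path v∈K)) ]′ (ends (old bd v∉) eq))

  -- Slot i is given up except for its segments F and K, which the new geodesic connects.
  record Detour {R} (st : State R) (i : Fin (suc t)) : Set where
    open State st
    field
      {u w}    : V
      bu       : Border R u
      bw       : Border R w
      F K      : List V
      F⊆       : ∀ {v} → v ∈ F → v ∈ Q i
      K⊆       : ∀ {v} → v ∈ K → v ∈ Q i
      F-unique : Unique F
      K-unique : Unique K
      F#K      : Disjoint F K
      ends     : ∀ {v} → Border R v → lab v ≡ slot i → v ∈ F ⊎ v ∈ K
      {s₀ e₀}  : V
      ls       : lab s₀ ≡ core true
      le       : lab e₀ ≡ core false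
      complete : ∀ {xs} → Walk u xs w → Walk s₀ (F ++ xs ++ K) e₀

  -- The cop of slot `i` abandons its old post, so every border vertex in its charge must be an end
  -- of the geodesic, where the new guard has fixed points. Vertices with other wardens stay
  -- protected as before.
  reroute : ∀ {R} → (∀ {R′} → R′ ⊂ R → Winning R′) → (g : Fin (suc (suc t)) → V → V) →
    (∀ j → Guards R (g j)) → ConnectedOn G (_∈ˢ R) →
    (∀ {v} → Border R v → ∃ λ j → g (suc j) v ≡ v) →
    (st : State R) (i : Fin (suc t)) (δ : Detour st i) →
    (∀ {v} → Border R v → let ω = warden (State.lab st v) in
      (ω ≢ i × g (suc ω) v ≡ v) ⊎ (ω ≡ i × (v ≡ Detour.u δ ⊎ v ≡ Detour.w δ))) →
    ∀ {r} → r ∈ˢ R → Win (λ j → g j r) r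
  reroute {R} smaller g guards R-conn cover st i δ roles =
    replaceGuard g guards i γ.track
      (let (v , v∈) = γ.hit in v , γ.within v∈ , γ.fix v∈)
      cover
      (λ bd → [ (λ (ω≢i , fix) → inj₁ (_ , ω≢i , fix)) , (λ (_ , end) → inj₂ (fix-end end)) ]′ (roles bd))
      λ R′⊂R conn′ guards′ free border →
        let (st′ , lab≡) = reroutedState st γ i F K F⊆ K⊆ F-unique K-unique F#K ends
                             (s₀ , e₀ , ls , le , complete γ.walk) R′⊂R free border
        in smaller R′⊂R _ guards′ conn′ st′ (updated-roles g γ.guard i st′ λ {v} bd →
             subst (λ lab → (warden (lab v) ≢ i × g (suc (warden (lab v))) v ≡ v) ⊎ γ.guard v ≡ v × warden (lab v) ≡ i)
               (sym lab≡) (new-roles (border bd)))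
    where
    open State st
    open Detour δ
    γ : Geodesic R u w
    γ = geodesic R-conn bu bw
    module γ = Geodesic γ
    fix-end : ∀ {v} → v ≡ u ⊎ v ≡ w → γ.guard v ≡ v
    fix-end (inj₁ refl) = γ.fix-u
    fix-end (inj₂ refl) = γ.fix-w
    new-roles : ∀ {v} → (v ∈ˢ R × γ.guard v ≡ v) ⊎ Border R v →
      let ω = warden (relabel γ.path (slot i) lab v) in (ω ≢ i × g (suc ω) v ≡ v) ⊎ γ.guard v ≡ v × ω ≡ i
    new-roles {v} h with v ∈ᴸ? γ.path | h
    ... | yes v∈ | _ = inj₂ (γ.fix v∈ , refl)
    ... | no v∉ | inj₁ (v∈ , fix) = contradiction (γ.on-path v∈ fix) v∉
    ... | no v∉ | inj₂ bd = [ inj₁ , (λ (eq , end) → inj₂ (fix-end end , eq)) ]′ (roles bd)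

  -- A guard alternating between two vertices at most one step apart protects both, wherever the
  -- robber goes. So `x` and `y` can serve as the cores of a state without paths, and `y` is the
  -- vertex that `R` loses.
  restart : ∀ {R} → (∀ {R′} → R′ ⊂ R → Winning R′) → (g : Fin (suc (suc t)) → V → V) →
    (∀ j → Guards R (g j)) → (∀ {v} → Border R v → ∃ λ j → g (suc j) v ≡ v) →
    ∀ {x y} → Move x y → y ∈ˢ R → (∀ {v} → Border R v → v ≡ x) →
    ∀ {r} → r ∈ˢ R → Win (λ j → g j r) r
  restart {R} smaller g guards cover {x} {y} xy y∈ only =
    replaceGuard g guards zero track (y , y∈ , fix-y) cover (λ bd → inj₂ (subst (λ v → h v ≡ v) (sym (only bd)) fix-x))
      λ {R′} R′⊂R conn′ guards′ free border →
        let st = fresh free border in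
        smaller R′⊂R _ guards′ conn′ st (updated-roles g h zero st λ {v} bd → inj₂ (fixed (border bd) , zero-warden v))
    where
    p : ℕ → V
    p zero    = x
    p (suc _) = y
    f : V → ℕ
    f v with v ≟ x
    ... | yes _ = 0
    ... | no _  = 1
    f≤1 : ∀ v → f v ≤ 1
    f≤1 v with v ≟ x
    ... | yes _ = z≤n
    ... | no _  = ≤-refl
    p-move : ∀ j k → Move (p j) (p k)
    p-move zero    zero    = refl
    p-move zero    (suc _) = xy
    p-move (suc _) zero    = move-sym xy
    p-move (suc _) (suc _) = refl
    track : Track R
    track = record
      { p = p ; f = f ; p-step = λ k → p-move k (suc k)
      ; f-lip = λ {r} _ _ _ → ≤-trans (f≤1 r) (s≤s z≤n)
      ; exit = λ {r} {r′} _ _ _ fix → subst (Move (p (f r))) fix (p-move (f r) (f r′))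
      }
    h : V → V
    h = p ∘ f
    fix-x : h x ≡ x
    fix-x with x ≟ x
    ... | yes _  = refl
    ... | no x≢x = contradiction refl x≢x
    fix-y : h y ≡ y
    fix-y with y ≟ x
    ... | yes eq = sym eq
    ... | no _   = refl
    h-range : ∀ v → h v ≡ x ⊎ h v ≡ y
    h-range v with f v
    ... | zero  = inj₁ refl
    ... | suc _ = inj₂ refl
    fixed : ∀ {v} → (v ∈ˢ R × h v ≡ v) ⊎ Border R v → h v ≡ v
    fixed (inj₁ (_ , fix)) = fix
    fixed (inj₂ bd) = subst (λ v → h v ≡ v) (sym (only bd)) fix-x
    -- If `x` and `y` coincide, the vertex goes to core `false` and core `true` is empty.
    lab : V → Label (suc t)
    lab v with v ≟ y | v ≟ x
    ... | yes _ | _     = core false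
    ... | no _  | yes _ = core true
    ... | no _  | no _  = out
    vertex : Bool → V
    vertex true  = x
    vertex false = y
    lab-core : ∀ s {v} → lab v ≡ core s → v ≡ vertex s
    lab-core s {v} eq with v ≟ y | v ≟ x
    lab-core false _  | yes v≡y | _ = v≡y
    lab-core true  () | yes _   | _
    lab-core true  _  | no _    | yes v≡x = v≡x
    lab-core false () | no _    | yes _
    lab-core _     () | no _    | no _
    lab-out : ∀ {v} → lab v ≡ out → ¬ (v ≡ x ⊎ v ≡ y)
    lab-out {v} eq v≡ with v ≟ y | v ≟ x
    lab-out () _ | yes _ | _
    lab-out () _ | no _ | yes _
    lab-out _ (inj₁ v≡x) | no _ | no v≢x = v≢x v≡x
    lab-out _ (inj₂ v≡y) | no v≢y | no _ = v≢y v≡y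
    elsewhere : ∀ {v} → v ≢ x → v ≢ y → lab v ≡ out
    elsewhere {v} v≢x v≢y with v ≟ y | v ≟ x
    ... | yes v≡y | _       = contradiction v≡y v≢y
    ... | no _    | yes v≡x = contradiction v≡x v≢x
    ... | no _    | no _    = refl
    out-lab : ∀ {v} → h v ≢ v → lab v ≡ out
    out-lab ¬fix = elsewhere (λ { refl → ¬fix fix-x }) (λ { refl → ¬fix fix-y })
    lab-slot : ∀ {v i} → lab v ≢ slot i
    lab-slot {v} eq with v ≟ y | v ≟ x
    lab-slot () | yes _ | _
    lab-slot () | no _ | yes _
    lab-slot () | no _ | no _
    zero-warden : ∀ v → warden (lab v) ≡ zero
    zero-warden v with v ≟ y | v ≟ x
    ... | yes _ | _     = refl
    ... | no _  | yes _ = refl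
    ... | no _  | no _  = refl
    fresh : ∀ {R′} → (∀ {v} → v ∈ˢ R′ → h v ≢ v) →
      (∀ {v} → Border R′ v → (v ∈ˢ R × h v ≡ v) ⊎ Border R v) → State R′
    fresh free border = record
      { lab      = lab
      ; R-out    = λ v∈ → out-lab (free v∈)
      ; conn     = λ s {v} {v′} p q → subst (Within G (λ v → lab v ≡ core s) v) (trans (lab-core s p) (sym (lab-core s q))) ε
      ; Q        = λ _ → []
      ; Q-lab    = λ _ ()
      ; Q-unique = λ _ → []
      ; Q-walk   = λ _ → inj₁ refl
      ; on-Q     = λ _ eq → contradiction eq lab-slot
      ; single   = λ s _ _ p q → trans (lab-core s p) (sym (lab-core s q))
      ; labelled = λ {v} bd eq → lab-out eq
                     (subst (λ z → z ≡ x ⊎ z ≡ y) (fixed (border bd)) (h-range v))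
      }

-- Capture

module Capture {n : ℕ} (G : Graph (Fin n)) (G-connected : Connected G) (t : ℕ)
               (minorFree : MinorFree (U (H t)) G) where
  open Graph G
  open Pursuit G
  open Guarding G G-connected
  open Geodesics G G-connected
  open Walks G G-connected
  open States G G-connected t
  open Rerouting G G-connected t

  private
    V = Fin n
    _∈ᴸ?_ = member? (_≟_ {n})

  module _ {R : Subset n} (R-conn : ConnectedOn G (_∈ˢ R)) {r : V} (r∈ : r ∈ˢ R) (st : State R)
           (cores : ∀ s → Attached st (core s))
           (many : ∀ j → Many (border? R) (State.Q st (suc j))) where
    open State st

    private
      segment : Fin t → Fin 3 → List V
      segment j 0F = Many.xs₁ (many j)
      segment j 1F = Many.xs₂ (many j)
      segment j 2F = Many.xs₃ (many j)

      segment-border : ∀ j k → ∃ λ v → v ∈ segment j k × Border R v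
      segment-border j 0F = Many.hit₁ (many j)
      segment-border j 1F = Many.hit₂ (many j)
      segment-border j 2F = Many.hit₃ (many j)

      Q≡ : ∀ j → Q (suc j) ≡ segment j 0F ++ segment j 1F ++ segment j 2F
      Q≡ j = Many.split (many j)

      segment⊆Q : ∀ j k {v} → v ∈ segment j k → v ∈ Q (suc j)
      segment⊆Q j 0F {v} v∈ = subst (v ∈_) (sym (Q≡ j)) (∈-++⁺ˡ v∈)
      segment⊆Q j 1F {v} v∈ = subst (v ∈_) (sym (Q≡ j)) (∈-++⁺ʳ (segment j 0F) (∈-++⁺ˡ v∈))
      segment⊆Q j 2F {v} v∈ = subst (v ∈_) (sym (Q≡ j)) (∈-++⁺ʳ (segment j 0F) (∈-++⁺ʳ (segment j 1F) v∈))

      segment-unique : ∀ j k k′ {v} → v ∈ segment j k → v ∈ segment j k′ → k ≡ k′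
      segment-unique j k k′ p q with unique-++⁻ (segment j 0F) (subst Unique (Q≡ j) (Q-unique (suc j)))
      ... | _ , u , dis with unique-++⁻ (segment j 1F) u
      ...   | _ , _ , dis′ = go k k′ p q
        where
        go : ∀ k k′ {v} → v ∈ segment j k → v ∈ segment j k′ → k ≡ k′
        go 0F 0F _ _ = refl
        go 0F 1F p q = ⊥-elim (dis (p , ∈-++⁺ˡ q))
        go 0F 2F p q = ⊥-elim (dis (p , ∈-++⁺ʳ (segment j 1F) q))
        go 1F 0F p q = ⊥-elim (dis (q , ∈-++⁺ˡ p))
        go 1F 1F _ _ = refl
        go 1F 2F p q = ⊥-elim (dis′ (p , q))
        go 2F 0F p q = ⊥-elim (dis (q , ∈-++⁺ʳ (segment j 1F) p))
        go 2F 1F p q = ⊥-elim (dis′ (q , p))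
        go 2F 2F _ _ = refl

      Branch : Maybe (Hᵥ t) → V → Set
      Branch nothing              v = v ∈ˢ R
      Branch (just a)             v = lab v ≡ core true
      Branch (just b)             v = lab v ≡ core false
      Branch (just (inner j k))   v = v ∈ segment j k

      -- Reading the branch sets off `lab` makes them disjoint by construction, except for segments
      -- of the same path, which `segment-unique` separates.
      classify : V → Label (suc t) → Maybe (Maybe (Hᵥ t))
      classify v out with v ∈? R
      ... | yes _ = just nothing
      ... | no _  = nothing
      classify v (core true)    = just (just a)
      classify v (core false)   = just (just b)
      classify v (slot zero)    = nothing
      classify v (slot (suc j)) with any? (λ k → v ∈ᴸ? segment j k)
      ... | yes (k , _) = just (just (inner j k))
      -- A slot label can be left over from a path that has since been rerouted; such a vertex joins
      -- no branch set.
      ... | no _        = nothing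

      classify-sound : ∀ v {w} → classify v (lab v) ≡ just w → Branch w v
      classify-sound v eq with lab v in l
      classify-sound v eq | out with v ∈? R
      classify-sound v refl | out | yes v∈ = v∈
      classify-sound v refl | core true  = l
      classify-sound v refl | core false = l
      classify-sound v eq | slot (suc j) with any? (λ k → v ∈ᴸ? segment j k)
      classify-sound v refl | slot (suc j) | yes (k , v∈) = v∈

      classify-complete : ∀ {v} w → Branch w v → classify v (lab v) ≡ just w
      classify-complete {v} nothing v∈ rewrite R-out v∈ with v ∈? R
      ... | yes _ = refl
      ... | no v∉ = contradiction v∈ v∉
      classify-complete (just a) l rewrite l = refl
      classify-complete (just b) l rewrite l = refl
      classify-complete {v} (just (inner j k)) v∈ rewrite Q-lab (suc j) (segment⊆Q j k v∈)
        with any? (λ k → v ∈ᴸ? segment j k)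
      ... | yes (k′ , v∈′) rewrite segment-unique j k k′ v∈ v∈′ = refl
      ... | no ∉ = contradiction (k , v∈) ∉

      segmentWalk : ∀ j → ∃₂ λ s e → lab s ≡ core true × lab e ≡ core false ×
        Walk s (segment j 0F ++ segment j 1F ++ segment j 2F ++ []) e
      segmentWalk j with Q-walk (suc j)
      ... | inj₁ empty = contradiction (subst (_ ∈_) empty (segment⊆Q j 0F (proj₁ (proj₂ (segment-border j 0F))))) λ ()
      ... | inj₂ (s , e , ls , le , W) = s , e , ls , le ,
        subst (λ l → Walk s l e)
          (trans (Q≡ j) (cong (λ l → segment j 0F ++ segment j 1F ++ l) (sym (++-identityʳ (segment j 2F))))) W

      branch-connected : ∀ w → ConnectedOn G (Branch w)
      branch-connected nothing  = R-conn
      branch-connected (just a) = conn true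
      branch-connected (just b) = conn false
      branch-connected (just (inner j k)) with segmentWalk j
      ... | _ , _ , _ , _ , W with walk-drop (segment j 0F) W
      ...   | _ , W₁ with walk-drop (segment j 1F) W₁
      ...     | _ , W₂ = go k
        where
        go : ∀ k → ConnectedOn G (_∈ segment j k)
        go 0F = walk-connected (segment j 0F) W
        go 1F = walk-connected (segment j 1F) W₁
        go 2F = walk-connected (segment j 2F) W₂

      branch-border : ∀ w → ∃ λ v → Branch (just w) v × Border R v
      branch-border a           = let (v , bd , l) = cores true in v , l , bd
      branch-border b           = let (v , bd , l) = cores false in v , l , bd
      branch-border (inner j k) = segment-border j k

      Joined : Maybe (Hᵥ t) → Maybe (Hᵥ t) → Set
      Joined w w′ = ∃₂ λ x y → Branch w x × Branch w′ y × x ~ y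

      joined-sym : ∀ {w w′} → Joined w w′ → Joined w′ w
      joined-sym (x , y , p , q , e) = y , x , q , p , ~-sym e

      joined-path : ∀ j k → Joined (just (glue j (inject₁ k))) (just (glue j (suc k)))
      joined-path j k with segmentWalk j
      ... | s , e , ls , le , W with walk-drop (segment j 0F) W
      ...   | _ , W₁ with walk-drop (segment j 1F) W₁
      ...     | _ , W₂ = go k
        where
        mem : ∀ k → proj₁ (segment-border j k) ∈ segment j k
        mem k = proj₁ (proj₂ (segment-border j k))
        go : ∀ k → Joined (just (glue j (inject₁ k))) (just (glue j (suc k)))
        go 0F = let (y , y∈ , e) = walk-first W (mem 0F) in s , y , ls , y∈ , e
        go 1F = walk-join (segment j 0F) W (mem 0F) (mem 1F)
        go 2F = walk-join (segment j 1F) W₁ (mem 1F) (mem 2F)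
        go 3F = let (x , x∈ , e′) = walk-last (subst (λ l → Walk _ l e) (++-identityʳ (segment j 2F)) W₂) (mem 2F)
                in x , e , x∈ , le , e′

      joined-apex : ∀ w → Joined (just w) nothing
      joined-apex w = let (v , p , (_ , u , u∈ , e)) = branch-border w in v , u , p , u∈ , ~-sym e

      joined : ∀ w w′ → Graph._~_ (U (H t)) w w′ → Joined w w′
      joined (just _) (just _) (inj₁ (j , k , refl , refl)) = joined-path j k
      joined (just _) (just _) (inj₂ (j , k , refl , refl)) = joined-sym (joined-path j k)
      joined (just w) nothing  _ = joined-apex w
      joined nothing  (just w) _ = joined-sym (joined-apex w)

    hasMinor : HasMinor G (U (H t))
    hasMinor = model⇒HasMinor (≡-dec _≟ᴴ_) (U (H t)) record
      { label     = λ v → classify v (lab v)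
      ; inhabited = λ w → let (v , p) = member w in v , classify-complete w p
      ; connected = λ w p q → Star.map
          (λ (e , x , y) → e , classify-complete w x , classify-complete w y)
          (branch-connected w (classify-sound _ p) (classify-sound _ q))
      ; edge      = λ {w} {w′} e → let (x , y , p , q , e′) = joined w w′ e in
          x , y , classify-complete w p , classify-complete w′ q , e′
      }
      where
      member : ∀ w → ∃ (Branch w)
      member nothing  = r , r∈
      member (just w) = let (v , p , _) = branch-border w in v , p

  firstFew : ∀ {k} {A B : Fin k → Set} → (∀ j → A j ⊎ B j) → ∃ A ⊎ (∀ j → B j)
  firstFew {zero} f = inj₂ λ ()
  firstFew {suc k} f with f zero | firstFew (f ∘ suc)
  ... | inj₁ x | _ = inj₁ (zero , x)
  ... | inj₂ _ | inj₁ (j , x) = inj₁ (suc j , x)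
  ... | inj₂ y | inj₂ ys = inj₂ λ { zero → y ; (suc j) → ys j }

  emptyDetour : ∀ {R} (st : State R) i → ((v , _) : Attached st (core true)) → ((w , _) : Attached st (core false)) →
    ¬ Attached st (slot i) → Detour st i
  emptyDetour st i (u , bu , lu) (w , bw , lw) ¬att = record
    { bu = bu ; bw = bw ; F = [] ; K = []
    ; F⊆ = λ () ; K⊆ = λ () ; F-unique = [] ; K-unique = [] ; F#K = λ ()
    ; ends = λ bd eq → contradiction (_ , bd , eq) ¬att
    ; ls = lu ; le = lw
    ; complete = λ {xs} W → subst (λ l → Walk u l w) (sym (++-identityʳ xs)) W
    }

  module _ {R : Subset n} (st : State R) (i : Fin (suc t)) where
    open State st

    nonemptyWalk : ∀ {pre x post} → Q i ≡ pre ++ x ∷ post →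
      ∃₂ λ s e → lab s ≡ core true × lab e ≡ core false × Walk s (pre ++ x ∷ post) e
    nonemptyWalk {pre} {x} {post} eq with Q-walk i
    ... | inj₁ empty = contradiction (subst (x ∈_) (trans (sym eq) empty) (∈-++⁺ʳ pre (here refl))) λ ()
    ... | inj₂ (s , e , ls , le , W) = s , e , ls , le , subst (λ l → Walk s l e) eq W

    -- Two border vertices are themselves the ends of the detour. A missing one is replaced by the
    -- border vertex of a core: with a single `x`, the geodesic runs from core `true` to `x` and the
    -- piece before `x` is dropped; with none, it joins the two cores and replaces the whole path.
    fewDetour : (∀ s → Attached st (core s)) → Few (border? R) (Q i) →
      ∃ λ (δ : Detour st i) → ∀ {v} → Border R v → lab v ≡ slot i → v ≡ Detour.u δ ⊎ v ≡ Detour.w δ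
    fewDetour cores (none ¬bd) = emptyDetour st i (cores true) (cores false) (λ (v , bd , l) → ¬bd (on-Q bd l) bd) ,
      λ bd l → contradiction bd (¬bd (on-Q bd l))
    fewDetour cores (one pre x post eq bx only) with nonemptyWalk eq | cores true
    ... | s , e , ls , le , W | u , bu , lu = record
      { bu = bu ; bw = bx ; F = [] ; K = x ∷ post
      ; F⊆ = λ () ; K⊆ = λ v∈ → subst (_ ∈_) (sym eq) (∈-++⁺ʳ pre v∈)
      ; F-unique = [] ; K-unique = proj₁ (proj₂ (unique-++⁻ pre (subst Unique eq (Q-unique i)))) ; F#K = λ { (() , _) }
      ; ends = λ bd l → inj₂ (here (only (on-Q bd l) bd))
      ; ls = lu ; le = le
      ; complete = λ {xs} W′ → walk-++ xs W′ (proj₂ (walk-split pre W))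
      } , λ bd l → inj₂ (only (on-Q bd l) bd)
    fewDetour cores (two pre x mid y post eq bx by only) with nonemptyWalk eq
    ... | s , e , ls , le , W = record
      { bu = bx ; bw = by ; F = pre ++ x ∷ [] ; K = y ∷ post
      ; F⊆ = λ v∈ → subst (_ ∈_) (sym eq′) (∈-++⁺ˡ v∈)
      ; K⊆ = λ v∈ → subst (_ ∈_) (sym eq′) (∈-++⁺ʳ (pre ++ x ∷ []) (∈-++⁺ʳ mid v∈))
      ; F-unique = proj₁ parts
      ; K-unique = proj₁ (proj₂ (unique-++⁻ mid (proj₁ (proj₂ parts))))
      ; F#K = λ (p , q) → proj₂ (proj₂ parts) (p , ∈-++⁺ʳ mid q)
      ; ends = λ bd l → [ (λ { refl → inj₁ (∈-++⁺ʳ pre (here refl)) }) , (λ v≡y → inj₂ (here v≡y)) ]′ (only (on-Q bd l) bd)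
      ; ls = ls ; le = le
      ; complete = λ {xs} W′ → subst (λ l → Walk s l e) (sym (++-assoc pre (x ∷ []) (xs ++ y ∷ post)))
          (walk-++ pre (proj₁ (walk-split pre W)) (walk-++ xs W′ (proj₂ (walk-split mid (proj₂ (walk-split pre W))))))
      } , λ bd l → only (on-Q bd l) bd
      where
      eq′ : Q i ≡ (pre ++ x ∷ []) ++ mid ++ y ∷ post
      eq′ = trans eq (sym (++-assoc pre (x ∷ []) _))
      parts : Unique (pre ++ x ∷ []) × Unique (mid ++ y ∷ post) × Disjoint (pre ++ x ∷ []) (mid ++ y ∷ post)
      parts = unique-++⁻ (pre ++ x ∷ []) (subst Unique eq′ (Q-unique i))

  ≼-trans : ∀ {R} {x y z : State R} → x ≼ y → y ≼ z → x ≼ z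
  ≼-trans p q = record { slot⁻ = λ e → _≼_.slot⁻ p (_≼_.slot⁻ q e) ; core⁺ = λ e → _≼_.core⁺ q (_≼_.core⁺ p e) }

  ≼-attached : ∀ {R} {st st′ : State R} → st ≼ st′ → ∀ {s} → Attached st (core s) → Attached st′ (core s)
  ≼-attached p (v , bd , l) = v , bd , _≼_.core⁺ p l

  ≼-detached : ∀ {R} {st st′ : State R} → st ≼ st′ → ∀ {i} → ¬ Attached st (slot i) → ¬ Attached st′ (slot i)
  ≼-detached p ¬att (v , bd , l) = ¬att (v , bd , _≼_.slot⁻ p l)

  fillFromZero : ∀ {R} (st : State R) s {g} → Roles st g →
    ∃ λ st′ → Roles st′ g × st ≼ st′ × (Attached st′ (core s) ⊎ ¬ Attached st′ (slot zero))
  fillFromZero st s {g} roles with attached? st (core s) | attached? st (slot zero)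
  ... | yes att | _       = st , roles , ≼-refl , inj₁ att
  ... | no _    | no ¬att = st , roles , ≼-refl , inj₂ ¬att
  ... | no ¬att | yes att = state ,
    (λ {v} bd → subst (λ ω → g (suc ω) v ≡ v) (sym (warden≡ refl v)) (roles bd)) , extends , inj₁ attached
    where open Filled (fill st s zero ¬att att)

  fillFromAny : ∀ {R} (st : State R) s →
    ∃ λ st′ → st ≼ st′ × (Attached st′ (core s) ⊎ (∀ i → ¬ Attached st′ (slot i)))
  fillFromAny st s with attached? st (core s) | any? (λ i → attached? st (slot i))
  ... | yes att | _             = st , ≼-refl , inj₁ att
  ... | no _    | no ¬att       = st , ≼-refl , inj₂ λ i att → ¬att (i , att)
  ... | no ¬att | yes (i , att) = state , extends , inj₁ attached
    where open Filled (fill st s i ¬att att)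

  both : ∀ {P : Bool → Set} → P true → P false → ∀ s → P s
  both p q true  = p
  both p q false = q

  capture : ∀ R → Acc _⊂_ R → Winning R
  capture R (acc rec) g guards R-conn st₀ roles₀ {r} r∈ =
    let (st₁ , roles₁ , _ , h₁)    = fillFromZero st₀ true {g} roles₀
        (st₂ , roles₂ , 1≼2 , h₂) = fillFromZero st₁ false {g} roles₁
    in decide st₂ roles₂
         ([ (λ att → inj₁ (≼-attached 1≼2 att)) , (λ ¬att → inj₂ (≼-detached 1≼2 ¬att)) ]′ h₁) h₂
    where
    smaller : ∀ {R′} → R′ ⊂ R → Winning R′
    smaller R′⊂R = capture _ (rec R′⊂R)

    cover : ∀ {v} → Border R v → ∃ λ j → g (suc j) v ≡ v
    cover bd = _ , roles₀ bd

    full : (st : State R) → Roles st g → (∀ s → Attached st (core s)) → Win (λ j → g j r) r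
    full st roles cores with firstFew (λ j → few-or-many (border? R) (State.Q st (suc j)))
    ... | inj₂ many = contradiction (hasMinor R-conn r∈ st cores many) minorFree
    ... | inj₁ (j , few) with fewDetour st (suc j) cores few
    ...   | δ , only = reroute smaller g guards R-conn cover st (suc j) δ (λ {v} bd → go v bd) r∈
      where
      open State st
      go : ∀ v → Border R v → (warden (lab v) ≢ suc j × g (suc (warden (lab v))) v ≡ v) ⊎
        (warden (lab v) ≡ suc j × (v ≡ Detour.u δ ⊎ v ≡ Detour.w δ))
      go v bd with lab v in l | roles bd
      ... | out    | fix = inj₁ ((λ ()) , fix)
      ... | core _ | fix = inj₁ ((λ ()) , fix)
      ... | slot i | fix with i ≟ suc j
      ...   | no i≢    = inj₁ (i≢ , fix)
      ...   | yes refl = inj₂ (refl , only bd l)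

    -- Every border vertex lies in the only core that can still meet the border, and `single` allows
    -- it just one.
    alone : (st : State R) → ¬ (∀ s → Attached st (core s)) → (∀ i → ¬ Attached st (slot i)) → Win (λ j → g j r) r
    alone st ¬cores ¬slots with any? (border? R)
    -- Without any border, as at the start of the game, the vertex of the robber serves as both `x`
    -- and `y`.
    ... | no ¬bd = restart smaller g guards cover refl r∈ (λ bd → contradiction (_ , bd) ¬bd) r∈
    ... | yes (x , bx@(_ , y , y∈ , e)) = restart smaller g guards cover [ ~-sym e ] y∈ only r∈
      where
      open State st
      only : ∀ {v} → Border R v → v ≡ x
      only {v} bv with lab v in lv | lab x in lx
      ... | out    | _      = contradiction lv (labelled bv)
      ... | slot i | _      = contradiction (v , bv , lv) (¬slots i)
      ... | core _ | out    = contradiction lx (labelled bx)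
      ... | core _ | slot i = contradiction (x , bx , lx) (¬slots i)
      ... | core true  | core true  = single true bv bx lv lx
      ... | core false | core false = single false bv bx lv lx
      ... | core true  | core false = contradiction (both (v , bv , lv) (x , bx , lx)) ¬cores
      ... | core false | core true  = contradiction (both (x , bx , lx) (v , bv , lv)) ¬cores

    -- Roles may fail for the cores of `st`, which may have absorbed vertices of any slot. But their
    -- border vertices are the two ends of the geodesic laid through slot `zero`, so its guard
    -- protects them. The remaining border vertices had the same slot label in `st₂`, whose roles
    -- hold.
    joinCores : (st₂ st : State R) → Roles st₂ g → st₂ ≼ st → ¬ Attached st (slot zero) →
      (cores : ∀ s → Attached st (core s)) → Win (λ j → g j r) r
    joinCores st₂ st roles 2≼ ¬zero cores = reroute smaller g guards R-conn cover st zero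
      (emptyDetour st zero (cores true) (cores false) ¬zero) (λ {v} bd → go v bd) r∈
      where
      open State st
      go : ∀ v → Border R v → (warden (lab v) ≢ zero × g (suc (warden (lab v))) v ≡ v) ⊎
        (warden (lab v) ≡ zero × (v ≡ proj₁ (cores true) ⊎ v ≡ proj₁ (cores false)))
      go v bd with lab v in l
      ... | out          = contradiction l (labelled bd)
      ... | core true    = inj₂ (refl , inj₁ (single true bd (proj₁ (proj₂ (cores true))) l (proj₂ (proj₂ (cores true)))))
      ... | core false   = inj₂ (refl , inj₂ (single false bd (proj₁ (proj₂ (cores false))) l (proj₂ (proj₂ (cores false)))))
      ... | slot zero    = contradiction (v , bd , l) ¬zero
      ... | slot (suc i) = inj₁ ((λ ()) , subst (λ ℓ → g (suc (warden ℓ)) v ≡ v) (_≼_.slot⁻ 2≼ l) (roles bd))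

    -- A core still unattached after the attempt to fill it means that no slot had a border vertex
    -- to offer, which is the situation of `alone`.
    sparse : (st₂ : State R) → Roles st₂ g → ¬ Attached st₂ (slot zero) → Win (λ j → g j r) r
    sparse st₂ roles ¬zero with fillFromAny st₂ true
    ... | st₃ , 2≼3 , h₃ with fillFromAny st₃ false
    ...   | st₄ , 3≼4 , h₄ with attached? st₄ (core true) | attached? st₄ (core false)
    ...     | yes p | yes q = joinCores st₂ st₄ roles (≼-trans 2≼3 3≼4) (≼-detached (≼-trans 2≼3 3≼4) ¬zero) (both p q)
    ...     | no ¬p | _ = alone st₄ (λ cores → ¬p (cores true))
      ([ (λ att → contradiction (≼-attached 3≼4 att) ¬p) , (λ ¬att i → ≼-detached 3≼4 (¬att i)) ]′ h₃)
    ...     | yes _ | no ¬q = alone st₄ (λ cores → ¬q (cores false))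
      ([ (λ att → contradiction att ¬q) , (λ ¬att → ¬att) ]′ h₄)

    decide : (st : State R) → Roles st g → Attached st (core true) ⊎ ¬ Attached st (slot zero) →
      Attached st (core false) ⊎ ¬ Attached st (slot zero) → Win (λ j → g j r) r
    decide st roles (inj₁ p) (inj₁ q) = full st roles (both p q)
    decide st roles (inj₂ ¬zero) _    = sparse st roles ¬zero
    decide st roles _ (inj₂ ¬zero)    = sparse st roles ¬zero

  -- One cop for each of the `suc t` slots and one free cop. The whole graph has no border, so cops
  -- gathered at one vertex, with empty cores and paths, satisfy all the requirements vacuously.
  copsWin : V → Game.CopsWin G (suc (suc t))
  copsWin x = replies⇒CopsWin (const x) λ r → const x , (λ _ → refl) ,
    capture Subset.⊤ (⊂-wellFounded _) (λ _ → const x) (λ _ _ _ _ → refl)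
      (λ {u} {v} _ _ → Star.map (λ e → e , ∈⊤ , ∈⊤) (G-connected u v))
      (record
        { lab = const out ; R-out = λ _ → refl ; conn = λ _ () ; Q = const []
        ; Q-lab = λ _ () ; Q-unique = λ _ → [] ; Q-walk = λ _ → inj₁ refl
        ; on-Q = λ { _ () } ; single = λ { _ _ _ () } ; labelled = λ (v∉ , _) _ → v∉ ∈⊤
        })
      (λ (v∉ , _) → contradiction ∈⊤ v∉)
      ∈⊤

corollary5p8 : (t : ℕ) → t ≥ 1 → (n : ℕ) (G : Graph (Fin n)) → Connected G → MinorFree (U (H t)) G → ∃ λ c → IsCopNumber G c × c ≤ t + 2
-- The empty graph offers no vertex to place cops on, but zero cops win because the robber has none
-- either.
corollary5p8 t _ zero G connected minorFree =
  let (c , isCopNumber , c≤0) = Pursuit.copNumber≤ G {0} (Pursuit.replies⇒CopsWin G (λ ()) (λ ()))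
  in c , isCopNumber , ≤-trans c≤0 z≤n
corollary5p8 t _ (suc n) G connected minorFree =
  let (c , isCopNumber , c≤) = Pursuit.copNumber≤ G (Capture.copsWin G connected t minorFree zero)
  in c , isCopNumber , ≤-trans c≤ (≤-reflexive (+-comm 2 t))
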